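{- Let $(\bar a_i)_{i\in I}$ and $(\bar b_j)_{j\in J}$ be sequences of indiscernibles. (1) The algebraic kernel is a $\approx$-invariant: if $(\bar a_i)_{i\in I}\approx(\bar b_j)_{j\in J}$, then $\operatorname{aker}(\bar a_i)_{i\in I}=\operatorname{aker}(\bar b_j)_{j\in J}$. (2) If $(\bar a_i)_{i\in I}$ and $(\bar b_j)_{j\in J}$ are cleanly collinear, then $\operatorname{aker}(\bar a_i)_{i\in I}=\operatorname{acl}(\{\bar a_i\mid i\in I\})\cap\operatorname{acl}(\{\bar b_j\mid j\in J\})$. (3) $\operatorname{aker}(\bar a_i)_{i\in I}=\operatorname{acl}\operatorname{aker}(\bar a_i)_{i\in I}$. (4) $(\bar a_i)_{i\in I}$ is indiscernible over $\operatorname{aker}(\bar a_i)_{i\in I}$.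
   Context: $T$ is a complete consistent first-order theory (possibly many-sorted); we work in a big saturated model of $T$, with algebraic closure $\operatorname{acl}$. Tuples may be infinite, and $\operatorname{acl}(\{\bar a_i\mid i\in I\})$ means the algebraic closure of the set of all entries of all tuples $\bar a_i$. Sequences of indiscernibles are indexed by arbitrary infinite (small) linearly ordered sets. The algebraic kernel of a sequence of indiscernibles $(\bar a_i)_{i\in I}$ is the set $$\operatorname{aker}(\bar a_i)_{i\in I}=\{d\mid d\in\operatorname{acl}(\{\bar a_i\mid i\in I\})\text{ and }(\bar a_i)_{i\in I}\text{ is indiscernible over }d\}$$ (where $d$ ranges over single elements). Two sequences of indiscernibles $(\bar a_i)_{i\in I}$ and $(\bar b_j)_{j\in J}$ are cleanly collinear if one of their two concatenations (the sequence indexed by the disjoint union $I+J$ ordered so that $I<J$, or the one indexed by $J+I$ with $J<I$) is indiscernible. $\approx$ denotes the transitive closure of clean collinearity. -}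

module Defs where

open import Level using (Level; _⊔_; suc)
open import Data.Empty.Polymorphic using (⊥)
open import Data.Fin.Base as Fin using (Fin)
open import Data.List.Base using (List; []; _∷_; _++_; map)
open import Data.List.Membership.Propositional using () renaming (_∈_ to _∈ˡ_)
open import Data.List.Relation.Unary.All as All using (All; []; _∷_)
import Data.List.Relation.Unary.All.Properties as All
open import Data.List.Relation.Unary.Any using (here; there)
open import Data.Nat.Base using (ℕ)
open import Data.Product.Base using (Σ; Σ-syntax; ∃-syntax; _×_; _,_; proj₁; proj₂)
open import Data.Sum.Base using (_⊎_; inj₁; inj₂; [_,_])
open import Data.Sum.Properties using (inj₁-injective)
open import Data.Sum.Relation.Binary.LeftOrder using (_⊎-<_; ⊎-<-isStrictTotalOrder)
open import Data.Sum.Relation.Binary.Pointwise using (Pointwise-≡⇒≡; ≡⇒Pointwise-≡)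
open import Function.Base using (_∘_)
open import Function.Bundles using (_⇔_)
open import Relation.Binary.Construct.Closure.Transitive using (TransClosure)
open import Relation.Binary.Core using (Rel; _Preserves_⟶_)
open import Relation.Binary.Definitions using (tri<; tri≈; tri>; Trichotomous)
open import Relation.Binary.PropositionalEquality using (_≡_; isEquivalence; resp₂)
open import Relation.Binary.Structures using (IsStrictTotalOrder)
open import Relation.Nullary using (¬_)
open import Relation.Unary using (Pred; ∅; ｛_｝; _∈_; _⊆_; U)

private variable
  a ℓ m p : Level

Finite : {A : Set a} → Pred A p → Set (a ⊔ p)
Finite {A = A} P = Σ[ xs ∈ List A ] P ⊆ (_∈ˡ xs)

------------------------------------------------------------------------
-- Many-sorted first-order logic with equality

record Signature ℓ : Set (suc ℓ) where
  field
    Sort   : Set ℓ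
    FunSym : Set ℓ
    dom    : FunSym → List Sort
    cod    : FunSym → Sort
    RelSym : Set ℓ
    arity  : RelSym → List Sort

module _ (L : Signature ℓ) where
  open Signature L

  -- A context lists the sorts of the free variables; a variable is a
  -- position in it, and quantifiers bind position zero.
  data Term (Γ : List Sort) : Sort → Set ℓ where
    var : ∀ {s} → s ∈ˡ Γ → Term Γ s
    app : (f : FunSym) → All (Term Γ) (dom f) → Term Γ (cod f)

  infix  6 _==_
  infixr 5 _⇒_

  -- The remaining connectives and ∃ are classically definable.
  data Formula (Γ : List Sort) : Set ℓ where
    _==_ : ∀ {s} → Term Γ s → Term Γ s → Formula Γ
    rel : (R : RelSym) → All (Term Γ) (arity R) → Formula Γ
    ff  : Formula Γ
    _⇒_ : Formula Γ → Formula Γ → Formula Γ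
    all : (s : Sort) → Formula (s ∷ Γ) → Formula Γ

  Sentence : Set ℓ
  Sentence = Formula []

  Theory : Set (suc ℓ)
  Theory = Pred Sentence ℓ

  record Structure m : Set (ℓ ⊔ suc m) where
    field
      Carrier   : Sort → Set m
      inhabited : ∀ s → Carrier s
      funᴹ      : (f : FunSym) → All Carrier (dom f) → Carrier (cod f)
      relᴹ      : (R : RelSym) → Pred (All Carrier (arity R)) m

module _ {L : Signature ℓ} where
  open Signature L

  module _ (M : Structure L m) where
    open Structure M

    mutual
      evalTerm : ∀ {Γ s} → All Carrier Γ → Term L Γ s → Carrier s
      evalTerm ρ (var x)    = All.lookup ρ x
      evalTerm ρ (app f ts) = funᴹ f (evalTerms ρ ts)

      evalTerms : ∀ {Γ ss} → All Carrier Γ → All (Term L Γ) ss → All Carrier ss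
      evalTerms ρ []       = []
      evalTerms ρ (t ∷ ts) = evalTerm ρ t ∷ evalTerms ρ ts

    infix 3 _⊨_[_]

    _⊨_[_] : ∀ {Γ} → Formula L Γ → All Carrier Γ → Set m
    _⊨_[_] (t == u)   ρ = evalTerm ρ t ≡ evalTerm ρ u
    _⊨_[_] (rel R ts) ρ = relᴹ R (evalTerms ρ ts)
    _⊨_[_] ff         ρ = ⊥
    _⊨_[_] (φ ⇒ ψ)    ρ = _⊨_[_] φ ρ → _⊨_[_] ψ ρ
    _⊨_[_] (all s φ)  ρ = (c : Carrier s) → _⊨_[_] φ (c ∷ ρ)

    Models : Theory L → Set (ℓ ⊔ m)
    Models T = ∀ {σ} → σ ∈ T → _⊨_[_] σ []

  -- Consequence is tested on structures carried by Set ℓ, where ℓ is the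
  -- level of the signature; by the downward Löwenheim–Skolem theorem this
  -- is the same as testing it on all structures.
  Entails : Theory L → Sentence L → Set (suc ℓ)
  Entails T σ = (N : Structure L ℓ) → Models N T → N ⊨ σ [ [] ]

  Consistent : Theory L → Set (suc ℓ)
  Consistent T = ¬ Entails T ff

  Complete : Theory L → Set (suc ℓ)
  Complete T = ∀ σ → Entails T σ ⊎ Entails T (σ ⇒ ff)

------------------------------------------------------------------------
-- Linear orders

record InfiniteLinearOrder ℓ : Set (suc ℓ) where
  field
    Index              : Set ℓ
    _<_                : Rel Index ℓ
    isStrictTotalOrder : IsStrictTotalOrder _≡_ _<_
    infinite           : ¬ Finite {A = Index} U

infixr 6 _⊕_

-- The disjoint union, with every index of I below every index of J.
_⊕_ : InfiniteLinearOrder ℓ → InfiniteLinearOrder ℓ → InfiniteLinearOrder ℓ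
I ⊕ J = record
  { Index              = I.Index ⊎ J.Index
  ; _<_                = I._<_ ⊎-< J._<_
  ; isStrictTotalOrder = record
    { isStrictPartialOrder = record
      { isEquivalence = isEquivalence
      ; irrefl        = irrefl ∘ ≡⇒Pointwise-≡
      ; trans         = trans
      ; <-resp-≈      = resp₂ _
      }
    ; compare = cmp
    }
  ; infinite = λ (xs , all∈xs) → I.infinite (lefts xs , λ _ → ∈-lefts (all∈xs _))
  }
  where
  module I = InfiniteLinearOrder I
  module J = InfiniteLinearOrder J
  open IsStrictTotalOrder
    (⊎-<-isStrictTotalOrder I.isStrictTotalOrder J.isStrictTotalOrder)
    using (irrefl; trans; compare)

  cmp : Trichotomous _≡_ (I._<_ ⊎-< J._<_)
  cmp x y with compare x y
  ... | tri< lt ne ge = tri< lt (ne ∘ ≡⇒Pointwise-≡) ge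
  ... | tri≈ lt eq ge = tri≈ lt (Pointwise-≡⇒≡ eq) ge
  ... | tri> lt ne ge = tri> lt (ne ∘ ≡⇒Pointwise-≡) ge

  lefts : List (I.Index ⊎ J.Index) → List I.Index
  lefts []            = []
  lefts (inj₁ i ∷ xs) = i ∷ lefts xs
  lefts (inj₂ j ∷ xs) = lefts xs

  ∈-lefts : ∀ {i xs} → inj₁ i ∈ˡ xs → i ∈ˡ lefts xs
  ∈-lefts {xs = inj₁ _ ∷ _} (here eq)   = here (inj₁-injective eq)
  ∈-lefts {xs = inj₁ _ ∷ _} (there i∈)  = there (∈-lefts i∈)
  ∈-lefts {xs = inj₂ _ ∷ _} (there i∈)  = ∈-lefts i∈

------------------------------------------------------------------------
-- Types, saturation and algebraic closure

-- "Small" means: indexed by a type in Set ℓ, where ℓ is the level of the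
-- signature.
module _ {L : Signature ℓ} (M : Structure L m) where
  open Signature L
  open Structure M

  Element : Set (ℓ ⊔ m)
  Element = Σ Sort Carrier

  ParametersIn : Pred Element p → List Sort → Set (ℓ ⊔ m ⊔ p)
  ParametersIn A = All (λ s → Σ[ c ∈ Carrier s ] (s , c) ∈ A)

  values : ∀ {A : Pred Element p} {Δ} → ParametersIn A Δ → All Carrier Δ
  values = All.map proj₁

  -- Every finitely satisfiable small family of formulas with parameters,
  -- in one free variable, is realised.  The parameters occurring in a small
  -- family form a small set, and a small set of parameters admits only
  -- small families of distinct formulas, so this is realisation of all
  -- 1-types over small sets.
  Saturated : Set (suc ℓ ⊔ m)
  Saturated =
    (s : Sort) (K : Set ℓ) (Δ : K → List Sort)
    (φ : (k : K) → Formula L (s ∷ Δ k)) (e : (k : K) → All Carrier (Δ k)) →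
    ((ks : List K) → ∃[ c ] All (λ k → M ⊨ φ k [ c ∷ e k ]) ks) →
    ∃[ c ] ∀ k → M ⊨ φ k [ c ∷ e k ]

  acl : Pred Element p → Pred Element (ℓ ⊔ m ⊔ p)
  acl A (s , d) =
    Σ[ Δ ∈ List Sort ] Σ[ e ∈ ParametersIn A Δ ] Σ[ φ ∈ Formula L (s ∷ Δ) ]
      (M ⊨ φ [ d ∷ values e ]) ×
      Finite (λ c → M ⊨ φ [ c ∷ values e ])

  Tuple : {X : Set ℓ} → (X → Sort) → Set (ℓ ⊔ m)
  Tuple {X} σ = (x : X) → Carrier (σ x)

  restrict : {X : Set ℓ} {σ : X → Sort} → Tuple σ → (xs : List X) → All Carrier (map σ xs)
  restrict c xs = All.map⁺ (All.universal c xs)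

  -- c and c′ have the same type over A.  A formula in the possibly infinite
  -- tuple of variables X mentions only a finite list xs of them.
  SameTypeOver : Pred Element p → {X : Set ℓ} {σ : X → Sort} → Rel (Tuple σ) (ℓ ⊔ m ⊔ p)
  SameTypeOver A {X} {σ} c c′ =
    (xs : List X) (Δ : List Sort) (φ : Formula L (map σ xs ++ Δ))
    (e : ParametersIn A Δ) →
    (M ⊨ φ [ All.++⁺ (restrict c xs) (values e) ]) ⇔
    (M ⊨ φ [ All.++⁺ (restrict c′ xs) (values e) ])

------------------------------------------------------------------------
-- Sequences of indiscernibles

-- α is the common index type of the tuples, σ gives the sort of each
-- coordinate.
module _ {L : Signature ℓ} (M : Structure L m) {α : Set ℓ} (σ : α → Signature.Sort L) where

  record Sequence : Set (suc ℓ ⊔ m) where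
    field
      order : InfiniteLinearOrder ℓ
    open InfiniteLinearOrder order public
    field
      tuple : Index → Tuple M σ

  open Sequence

  flatten : (𝐚 : Sequence) {n : ℕ} → (Fin n → Index 𝐚) → Tuple M {Fin n × α} (σ ∘ proj₂)
  flatten 𝐚 i (k , x) = tuple 𝐚 (i k) x

  IndiscernibleOver : Pred (Element M) p → Sequence → Set (ℓ ⊔ m ⊔ p)
  IndiscernibleOver A 𝐚 =
    (n : ℕ) (i j : Fin n → Index 𝐚) →
    i Preserves Fin._<_ ⟶ _<_ 𝐚 → j Preserves Fin._<_ ⟶ _<_ 𝐚 →
    SameTypeOver M A {σ = σ ∘ proj₂} (flatten 𝐚 i) (flatten 𝐚 j)

  Indiscernible : Sequence → Set (ℓ ⊔ m)
  Indiscernible = IndiscernibleOver ∅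

  entries : Sequence → Pred (Element M) (ℓ ⊔ m)
  entries 𝐚 d = ∃[ i ] ∃[ x ] d ≡ (σ x , tuple 𝐚 i x)

  aker : Sequence → Pred (Element M) (ℓ ⊔ m)
  aker 𝐚 d = d ∈ acl M (entries 𝐚) × IndiscernibleOver ｛ d ｝ 𝐚

  concatenate : Sequence → Sequence → Sequence
  concatenate 𝐚 𝐛 = record
    { order = order 𝐚 ⊕ order 𝐛
    ; tuple = [ tuple 𝐚 , tuple 𝐛 ]
    }

  IndiscernibleSequence : Set (suc ℓ ⊔ m)
  IndiscernibleSequence = Σ Sequence Indiscernible

  CleanlyCollinear : Rel IndiscernibleSequence (ℓ ⊔ m)
  CleanlyCollinear (𝐚 , _) (𝐛 , _) =
    Indiscernible (concatenate 𝐚 𝐛) ⊎ Indiscernible (concatenate 𝐛 𝐚)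

  _≈_ : Rel IndiscernibleSequence (suc ℓ ⊔ m)
  _≈_ = TransClosure CleanlyCollinear

{-# OPTIONS --safe #-}
module Submission where

-- Let d ∈ aker (aᵢ) and choose, among all formulas χ(x, aₖ) algebraic over the
-- sequence and satisfied by d, one with as few solutions as possible. Since d
-- also satisfies χ(x, aₖ′) for every k′ ordered like k, minimality forces
-- χ(M, aₖ) = χ(M, aₖ′): the solution set does not depend on k. If (aᵢ) and (bⱼ)
-- are cleanly collinear this set is therefore also χ(M, bₗ), so d ∈ acl (bⱼ).
-- Conversely (aᵢ) is indiscernible over (bⱼ).
--
-- An element d of a finite set Y with an invariant definition can be added to
-- the parameters: a formula ψ(aᵢ, d) has finitely many truth patterns on Y, so by
-- the pigeonhole principle and indiscernibility all increasing tuples have the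
-- same pattern. With Y algebraic over the parameters this gives indiscernibility
-- over acl, and with Y = χ(M, aₖ) as above indiscernibility over aker. Everything
-- takes place inside finite pieces of the sequence, which need not be extended.

open import Level using (Level; Lift; lift; lower; _⊔_; suc)
open import Axiom.ExcludedMiddle using (ExcludedMiddle)
open import Data.Empty.Polymorphic using (⊥)
open import Data.Fin.Base as Fin using (Fin; combine; funToFin; finToFun)
open import Data.Fin.Properties as Fin
  using (pigeonhole; combine-monoˡ-<; finToFun-funToFin; toℕ-combine)
open import Data.List.Base using (List; []; _∷_; _++_; map; length; lookup; filter; allFin)
open import Data.List.Membership.Propositional renaming (_∈_ to _∈ˡ_; _∉_ to _∉ˡ_)
open import Data.List.Membership.Propositional.Properties
  using (∈-++⁺ˡ; ∈-++⁺ʳ; ∈-map⁺; ∈-filter⁺; ∈-allFin; ∈-lookup)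
import Data.List.Properties as List
open import Data.List.Relation.Binary.Permutation.Propositional
  using (_↭_; ↭-refl; ↭-sym; prep; ↭-trans)
open import Data.List.Relation.Binary.Permutation.Propositional.Properties
  using (↭-length; ∈-resp-↭; All-resp-↭)
open import Data.List.Relation.Unary.All as All using (All; []; _∷_)
import Data.List.Relation.Unary.All.Properties as All
open import Data.List.Relation.Unary.AllPairs using (AllPairs; []; _∷_)
open import Data.List.Relation.Unary.Any as Any using (here; there; any?)
open import Data.List.Relation.Unary.Any.Properties using (lookup-index)
open import Data.Nat.Base as ℕ using (ℕ; zero; z≤n; s≤s; s≤s⁻¹)
import Data.Nat.Properties as ℕ
open import Data.Product.Base using (Σ; Σ-syntax; ∃-syntax; _×_; _,_; proj₁; proj₂; swap)
open import Data.Sum.Base as Sum using (_⊎_; inj₁; inj₂; [_,_]; [_,_]′)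
open import Data.Sum.Relation.Binary.LeftOrder using (₁∼₁; ₁∼₂; ₂∼₂)
open import Data.Unit.Polymorphic using (⊤; tt)
open import Function.Base using (_∘_; id)
open import Function.Bundles using (_⇔_; mk⇔; Equivalence)
import Relation.Binary.Construct.Closure.Transitive as Plus
open import Relation.Binary.Core using (Rel; _Preserves_⟶_)
open import Relation.Binary.Definitions using (tri<; tri≈; tri>)
open import Relation.Binary.PropositionalEquality
  using (_≡_; _≢_; refl; sym; trans; cong; cong₂; subst)
open import Relation.Binary.Structures using (IsStrictTotalOrder)
open import Relation.Nullary using (¬_; Dec; yes; no; contradiction)
open import Relation.Nullary.Decidable using (map′; ¬?; decidable-stable)
open import Relation.Unary using (Pred; ∅; ｛_｝; _∈_; _⊆_; _≐_; _∩_; U)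
open import Defs

open Equivalence using (to; from)

private variable
  a p q r v x : Level
  A B C X Y : Set a

-- Variables and environments in concatenated contexts.

module _ {S : Set a} where
  private variable
    Γ Δ Ξ : List S
    s t : S

  insertVar : ∀ Ξ → t ∈ˡ Ξ ++ Δ → t ∈ˡ Ξ ++ s ∷ Δ
  insertVar []      x         = there x
  insertVar (_ ∷ Ξ) (here eq) = here eq
  insertVar (_ ∷ Ξ) (there x) = there (insertVar Ξ x)

  module _ {F : S → Set p} where
    lookup-insertVar : (ρ : All F Ξ) (ρ′ : All F Δ) (c : F s) (x : t ∈ˡ Ξ ++ Δ) →
      All.lookup (All.++⁺ ρ (c ∷ ρ′)) (insertVar Ξ x) ≡ All.lookup (All.++⁺ ρ ρ′) x
    lookup-insertVar []      ρ′ c x           = refl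
    lookup-insertVar (_ ∷ ρ) ρ′ c (here refl) = refl
    lookup-insertVar (_ ∷ ρ) ρ′ c (there x)   = lookup-insertVar ρ ρ′ c x

    lookup-∈-++⁺ˡ : (ρ : All F Γ) (ρ′ : All F Δ) (x : t ∈ˡ Γ) →
      All.lookup (All.++⁺ ρ ρ′) (∈-++⁺ˡ x) ≡ All.lookup ρ x
    lookup-∈-++⁺ˡ (_ ∷ ρ) ρ′ (here refl) = refl
    lookup-∈-++⁺ˡ (_ ∷ ρ) ρ′ (there x)   = lookup-∈-++⁺ˡ ρ ρ′ x

    lookup-∈-++⁺ʳ : (ρ : All F Γ) (ρ′ : All F Δ) (x : t ∈ˡ Δ) →
      All.lookup (All.++⁺ ρ ρ′) (∈-++⁺ʳ Γ x) ≡ All.lookup ρ′ x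
    lookup-∈-++⁺ʳ []      ρ′ x = refl
    lookup-∈-++⁺ʳ (_ ∷ ρ) ρ′ x = lookup-∈-++⁺ʳ ρ ρ′ x

    map-++⁺ : {G : S → Set q} (f : ∀ {s} → G s → F s) (ρ : All G Γ) (ρ′ : All G Δ) →
      All.map f (All.++⁺ ρ ρ′) ≡ All.++⁺ (All.map f ρ) (All.map f ρ′)
    map-++⁺ f []      ρ′ = refl
    map-++⁺ f (c ∷ ρ) ρ′ = cong (f c ∷_) (map-++⁺ f ρ ρ′)

-- Formulas

module _ {ℓ} {L : Signature ℓ} where
  open Signature L

  private variable
    Γ Δ Ξ : List Sort
    s t : Sort

  liftVar : (∀ {t} → t ∈ˡ Γ → t ∈ˡ Δ) → t ∈ˡ s ∷ Γ → t ∈ˡ s ∷ Δ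
  liftVar r (here eq) = here eq
  liftVar r (there x) = there (r x)

  mutual
    renameTerm : (∀ {t} → t ∈ˡ Γ → t ∈ˡ Δ) → Term L Γ s → Term L Δ s
    renameTerm r (var x)    = var (r x)
    renameTerm r (app f ts) = app f (renameTerms r ts)

    renameTerms : (∀ {t} → t ∈ˡ Γ → t ∈ˡ Δ) → All (Term L Γ) Ξ → All (Term L Δ) Ξ
    renameTerms r []       = []
    renameTerms r (t ∷ ts) = renameTerm r t ∷ renameTerms r ts

  rename : (∀ {t} → t ∈ˡ Γ → t ∈ˡ Δ) → Formula L Γ → Formula L Δ
  rename r (t == u)   = renameTerm r t == renameTerm r u
  rename r (rel R ts) = rel R (renameTerms r ts)
  rename r ff         = ff
  rename r (φ ⇒ ψ)    = rename r φ ⇒ rename r ψ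
  rename r (all s φ)  = all s (rename (liftVar r) φ)

  module _ {M : Structure L r} where
    open Structure M

    mutual
      eval-renameTerm : {f : ∀ {t} → t ∈ˡ Γ → t ∈ˡ Δ} {ρ : All Carrier Γ} {ρ′ : All Carrier Δ} →
        (∀ {t} (x : t ∈ˡ Γ) → All.lookup ρ′ (f x) ≡ All.lookup ρ x) →
        (u : Term L Γ s) → evalTerm M ρ′ (renameTerm f u) ≡ evalTerm M ρ u
      eval-renameTerm eq (var x)    = eq x
      eval-renameTerm eq (app g us) = cong (funᴹ g) (eval-renameTerms eq us)

      eval-renameTerms : {f : ∀ {t} → t ∈ˡ Γ → t ∈ˡ Δ} {ρ : All Carrier Γ} {ρ′ : All Carrier Δ} →
        (∀ {t} (x : t ∈ˡ Γ) → All.lookup ρ′ (f x) ≡ All.lookup ρ x) →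
        (us : All (Term L Γ) Ξ) → evalTerms M ρ′ (renameTerms f us) ≡ evalTerms M ρ us
      eval-renameTerms eq []       = refl
      eval-renameTerms eq (u ∷ us) = cong₂ _∷_ (eval-renameTerm eq u) (eval-renameTerms eq us)

    -- Both directions are proved together, since in `φ ⇒ ψ` the premise is carried the opposite
    -- way.
    ⊨-rename : {f : ∀ {t} → t ∈ˡ Γ → t ∈ˡ Δ} {ρ : All Carrier Γ} {ρ′ : All Carrier Δ} →
      (∀ {t} (x : t ∈ˡ Γ) → All.lookup ρ′ (f x) ≡ All.lookup ρ x) →
      (φ : Formula L Γ) → (M ⊨ rename f φ [ ρ′ ]) ⇔ (M ⊨ φ [ ρ ])
    ⊨-rename eq (t == u) = mk⇔
      (λ h → trans (sym (eval-renameTerm eq t)) (trans h (eval-renameTerm eq u)))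
      (λ h → trans (eval-renameTerm eq t) (trans h (sym (eval-renameTerm eq u))))
    ⊨-rename eq (rel R ts) = mk⇔
      (subst (relᴹ R) (eval-renameTerms eq ts))
      (subst (relᴹ R) (sym (eval-renameTerms eq ts)))
    ⊨-rename eq ff = mk⇔ id id
    ⊨-rename eq (φ ⇒ ψ) = mk⇔
      (λ h → to (⊨-rename eq ψ) ∘ h ∘ from (⊨-rename eq φ))
      (λ h → from (⊨-rename eq ψ) ∘ h ∘ to (⊨-rename eq φ))
    ⊨-rename eq (all s φ) = mk⇔
      (λ h c → to (⊨-rename (lift-eq c) φ) (h c))
      (λ h c → from (⊨-rename (lift-eq c) φ) (h c))
      where
      lift-eq : ∀ c {t} (x : t ∈ˡ s ∷ _) → All.lookup (c ∷ _) (liftVar _ x) ≡ All.lookup (c ∷ _) x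
      lift-eq c (here refl) = refl
      lift-eq c (there x)   = eq x

-- Order patterns of tuples

infix 4 _⟨_⟩≲⟨_⟩_

-- By trichotomy (≲-sym) one direction of each equivalence suffices to say that
-- v and v′ have the same order pattern.
record _⟨_⟩≲⟨_⟩_ {A : Set a} {B : Set p} {X : Set x}
  (v : X → A) (_<₁_ : Rel A q) (_<₂_ : Rel B r) (v′ : X → B) : Set (a ⊔ p ⊔ x ⊔ q ⊔ r) where
  constructor pattern-≲
  field
    lt : ∀ x y → v x <₁ v y → v′ x <₂ v′ y
    eq : ∀ x y → v x ≡ v y → v′ x ≡ v′ y

module _ {_<₁_ : Rel A p} {_<₂_ : Rel B q} where
  ≲-trans : {_<₃_ : Rel C r} {u : X → A} {v : X → B} {w : X → C} →
    u ⟨ _<₁_ ⟩≲⟨ _<₂_ ⟩ v → v ⟨ _<₂_ ⟩≲⟨ _<₃_ ⟩ w → u ⟨ _<₁_ ⟩≲⟨ _<₃_ ⟩ w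
  ≲-trans (pattern-≲ lt eq) (pattern-≲ lt′ eq′) =
    pattern-≲ (λ x y → lt′ x y ∘ lt x y) (λ x y → eq′ x y ∘ eq x y)

  ≲-∘ : {v : X → A} {v′ : X → B} (f : Y → X) →
    v ⟨ _<₁_ ⟩≲⟨ _<₂_ ⟩ v′ → (v ∘ f) ⟨ _<₁_ ⟩≲⟨ _<₂_ ⟩ (v′ ∘ f)
  ≲-∘ f (pattern-≲ lt eq) = pattern-≲ (λ x y → lt (f x) (f y)) (λ x y → eq (f x) (f y))

  ≲-monotone : {f : A → B} → f Preserves _<₁_ ⟶ _<₂_ → (v : X → A) → v ⟨ _<₁_ ⟩≲⟨ _<₂_ ⟩ (f ∘ v)
  ≲-monotone {f = f} mono v = pattern-≲ (λ _ _ → mono) (λ _ _ → cong f)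

≲-≗ : {_<_ : Rel A p} {v v′ : X → A} → (∀ x → v x ≡ v′ x) → v ⟨ _<_ ⟩≲⟨ _<_ ⟩ v′
≲-≗ {_<_ = _<_} v≗v′ = pattern-≲
  (λ x y h → subst (_< _) (v≗v′ x) (subst (_ <_) (v≗v′ y) h))
  (λ x y h → trans (sym (v≗v′ x)) (trans h (v≗v′ y)))

module _ {_<₁_ : Rel A p} {_<₂_ : Rel B q}
  (isSTO₁ : IsStrictTotalOrder _≡_ _<₁_) (isSTO₂ : IsStrictTotalOrder _≡_ _<₂_) where
  private
    module O₁ = IsStrictTotalOrder isSTO₁
    module O₂ = IsStrictTotalOrder isSTO₂

  ≲-sym : {v : X → A} {v′ : X → B} → v ⟨ _<₁_ ⟩≲⟨ _<₂_ ⟩ v′ → v′ ⟨ _<₂_ ⟩≲⟨ _<₁_ ⟩ v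
  ≲-sym {v = v} {v′} (pattern-≲ lt eq) = pattern-≲ lt⁻¹ eq⁻¹
    where
    lt⁻¹ : ∀ x y → v′ x <₂ v′ y → v x <₁ v y
    lt⁻¹ x y h with O₁.compare (v x) (v y)
    ... | tri< vx<vy _ _ = vx<vy
    ... | tri≈ _ vx≡vy _ = contradiction h (O₂.irrefl (eq x y vx≡vy))
    ... | tri> _ _ vy<vx = contradiction (lt y x vy<vx) (O₂.asym h)

    eq⁻¹ : ∀ x y → v′ x ≡ v′ y → v x ≡ v y
    eq⁻¹ x y h with O₁.compare (v x) (v y)
    ... | tri< vx<vy _ _ = contradiction (lt x y vx<vy) (O₂.irrefl h)
    ... | tri≈ _ vx≡vy _ = vx≡vy
    ... | tri> _ _ vy<vx = contradiction (lt y x vy<vx) (O₂.irrefl (sym h))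

  -- Comparisons across the two halves are strict and decided alike on both sides, so no equality
  -- across the halves can arise and the patterns of the halves settle the rest.
  ≲-⊎ : {v : X → A} {v′ : X → B} {w : Y → A} {w′ : Y → B} →
    v ⟨ _<₁_ ⟩≲⟨ _<₂_ ⟩ v′ → w ⟨ _<₁_ ⟩≲⟨ _<₂_ ⟩ w′ →
    (∀ x y → (v x <₁ w y × v′ x <₂ w′ y) ⊎ (w y <₁ v x × w′ y <₂ v′ x)) →
    [ v , w ]′ ⟨ _<₁_ ⟩≲⟨ _<₂_ ⟩ [ v′ , w′ ]′
  ≲-⊎ {X = X} {Y = Y} {v} {v′} {w} {w′} (pattern-≲ lt₁ eq₁) (pattern-≲ lt₂ eq₂) across =
    pattern-≲ lt eq
    where
    lt : ∀ x y → [ v , w ]′ x <₁ [ v , w ]′ y → [ v′ , w′ ]′ x <₂ [ v′ , w′ ]′ y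
    lt (inj₁ x) (inj₁ y) h = lt₁ x y h
    lt (inj₂ x) (inj₂ y) h = lt₂ x y h
    lt (inj₁ x) (inj₂ y) h with across x y
    ... | inj₁ (_ , h′) = h′
    ... | inj₂ (g , _)  = contradiction g (O₁.asym h)
    lt (inj₂ x) (inj₁ y) h with across y x
    ... | inj₁ (g , _)  = contradiction g (O₁.asym h)
    ... | inj₂ (_ , h′) = h′

    eq : ∀ x y → [ v , w ]′ x ≡ [ v , w ]′ y → [ v′ , w′ ]′ x ≡ [ v′ , w′ ]′ y
    eq (inj₁ x) (inj₁ y) h = eq₁ x y h
    eq (inj₂ x) (inj₂ y) h = eq₂ x y h
    eq (inj₁ x) (inj₂ y) h with across x y
    ... | inj₁ (g , _) = contradiction g (O₁.irrefl h)
    ... | inj₂ (g , _) = contradiction g (O₁.irrefl (sym h))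
    eq (inj₂ x) (inj₁ y) h with across y x
    ... | inj₁ (g , _) = contradiction g (O₁.irrefl (sym h))
    ... | inj₂ (g , _) = contradiction g (O₁.irrefl h)

-- Sorted enumerations and chains in linear orders.

combine-monoʳ-< : ∀ {m n} (t : Fin m) {i j : Fin n} → i Fin.< j → combine t i Fin.< combine t j
combine-monoʳ-< {n = n} t {i} {j} i<j
  rewrite toℕ-combine t i | toℕ-combine t j = ℕ.+-monoʳ-< (n ℕ.* Fin.toℕ t) i<j

lookup-mono : {R : Rel X p} {xs : List X} → AllPairs R xs → ∀ {i j} → i Fin.< j →
  R (lookup xs i) (lookup xs j)
lookup-mono (rxs ∷ _) {Fin.zero}  {Fin.suc j} _   = All.lookup rxs (∈-lookup j)
lookup-mono (_ ∷ rs)  {Fin.suc i} {Fin.suc j} i<j = lookup-mono rs (s≤s⁻¹ i<j)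

finite-Fin : ∀ n → Finite {A = Fin n} U
finite-Fin n = allFin n , λ _ → ∈-allFin _

finite-⊎ : {X : Set x} {Y : Set p} → Finite {A = X} U → Finite {A = Y} U → Finite {A = X ⊎ Y} U
finite-⊎ {X = X} {Y} (xs , ∈xs) (ys , ∈ys) = map inj₁ xs ++ map inj₂ ys , λ {z} _ → ∈all z
  where
  ∈all : (z : X ⊎ Y) → z ∈ˡ map inj₁ xs ++ map inj₂ ys
  ∈all (inj₁ x) = ∈-++⁺ˡ (∈-map⁺ inj₁ (∈xs _))
  ∈all (inj₂ y) = ∈-++⁺ʳ (map inj₁ xs) (∈-map⁺ inj₂ (∈ys _))

module Sorting {A : Set a} {_<_ : Rel A p} (isSTO : IsStrictTotalOrder _≡_ _<_) where
  private module O = IsStrictTotalOrder isSTO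

  SortedBy : {X : Set x} → (X → A) → List X → Set _
  SortedBy v = AllPairs (λ y z → v y < v z)

  -- The map `v` need not be injective: an item whose value already occurs is represented by the
  -- earlier one instead of being inserted.
  insert : {X : Set x} (v : X → A) (z : X) (ys : List X) → SortedBy v ys →
    (Σ[ y ∈ X ] y ∈ˡ ys × v z ≡ v y) ⊎ (Σ[ zs ∈ List X ] zs ↭ z ∷ ys × SortedBy v zs)
  insert v z [] _ = inj₂ (z ∷ [] , ↭-refl , [] ∷ [])
  insert v z (y ∷ ys) (y<ys ∷ sorted) with O.compare (v z) (v y)
  ... | tri< z<y _ _ =
    inj₂ (z ∷ y ∷ ys , ↭-refl , (z<y ∷ All.map (O.trans z<y) y<ys) ∷ y<ys ∷ sorted)
  ... | tri≈ _ z≡y _ = inj₁ (y , here refl , z≡y)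
  ... | tri> _ _ y<z with insert v z ys sorted
  ...   | inj₁ (y′ , y′∈ys , z≡y′) = inj₁ (y′ , there y′∈ys , z≡y′)
  ...   | inj₂ (zs , zs↭ , sorted′) = inj₂
    ( y ∷ zs
    , ↭-trans (prep y zs↭) (_↭_.swap y z ↭-refl)
    , All-resp-↭ (↭-sym zs↭) (y<z ∷ y<ys) ∷ sorted′
    )

  sort : {X : Set x} (v : X → A) (zs : List X) →
    Σ[ ys ∈ List X ] SortedBy v ys × (∀ {z} → z ∈ˡ zs → Σ[ y ∈ X ] y ∈ˡ ys × v z ≡ v y)
  sort v [] = [] , [] , λ ()
  sort v (z ∷ zs) with sort v zs
  ... | ys , sorted , rep with insert v z ys sorted
  ...   | inj₁ z-rep = ys , sorted , λ { (here refl) → z-rep ; (there ∈zs) → rep ∈zs }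
  ...   | inj₂ (ys′ , ys′↭ , sorted′) = ys′ , sorted′ , λ
    { (here refl) → z , ∈-resp-↭ (↭-sym ys′↭) (here refl) , refl
    ; (there ∈zs) → let y , ∈ys , eq = rep ∈zs in y , ∈-resp-↭ (↭-sym ys′↭) (there ∈ys) , eq
    }

  -- Indiscernibility speaks of strictly increasing tuples. An enumeration presents a finite tuple
  -- `v`, in any order and with repetitions, as an increasing tuple read through `position`.
  record Enumeration {X : Set x} (v : X → A) : Set (a ⊔ p ⊔ x) where
    field
      size     : ℕ
      select   : Fin size → X
      position : X → Fin size
      mono     : (v ∘ select) Preserves Fin._<_ ⟶ _<_
      factors  : ∀ z → v z ≡ v (select (position z))

  enumerate : {X : Set x} → Finite {A = X} U → (v : X → A) → Enumeration v
  enumerate (xs , ∈xs) v with sort v xs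
  ... | ys , sorted , rep = record
    { size     = length ys
    ; select   = lookup ys
    ; position = λ z → Any.index (proj₁ (proj₂ (rep (∈xs {z} _))))
    ; mono     = lookup-mono sorted
    ; factors  = λ z → let y , y∈ys , eq = rep (∈xs {z} _) in trans eq (cong v (lookup-index y∈ys))
    }

  module _ (em : ExcludedMiddle a) (infinite : ¬ Finite {A = A} U) where

    sorted-of-length : ∀ n → Σ[ xs ∈ List A ] length xs ≡ n × SortedBy id xs
    sorted-of-length ℕ.zero = [] , refl , []
    sorted-of-length (ℕ.suc n) with sorted-of-length n
    -- If nothing lay outside `xs`, then `xs` would list the whole order. Excluded middle thus turns
    -- non-finiteness into a fresh element.
    ... | xs , refl , sorted with em {P = Σ[ x ∈ A ] x ∉ˡ xs}
    ...   | no ∄fresh = contradiction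
      (xs , λ {x} _ → decidable-stable (any? (x O.≟_) xs) λ x∉ → ∄fresh (x , x∉)) infinite
    ...   | yes (x , x∉xs) with insert id x xs sorted
    ...     | inj₁ (y , y∈xs , refl) = contradiction y∈xs x∉xs
    ...     | inj₂ (ys , ys↭ , sorted′) = ys , ↭-length ys↭ , sorted′

    chain : ∀ n → Σ[ c ∈ (Fin n → A) ] c Preserves Fin._<_ ⟶ _<_
    chain n with sorted-of-length n
    ... | xs , refl , sorted = lookup xs , lookup-mono sorted

    record Blocks (m n : ℕ) : Set (a ⊔ p) where
      field
        block      : Fin m → Fin n → A
        block-mono : ∀ t → block t Preserves Fin._<_ ⟶ _<_
        block-<    : ∀ {s t} → s Fin.< t → ∀ i j → block s i < block t j

    -- One chain of length `m * n` is cut into consecutive segments: `combine` orders pairs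
    -- lexicographically, so the block number decides before the place inside the block.
    blocks : ∀ m n → Blocks m n
    blocks m n with chain (m ℕ.* n)
    ... | c , c↑ = record
      { block      = λ t → c ∘ combine t
      ; block-mono = λ t → c↑ ∘ combine-monoʳ-< t
      ; block-<    = λ s<t i j → c↑ (combine-monoˡ-< i j s<t)
      }

-- Definable predicates

module Definability {ℓ} (em : ExcludedMiddle (suc ℓ)) {L : Signature ℓ} (M : Structure L (suc ℓ)) where
  open Signature L
  open Structure M

  private variable
    s t : Sort
    Γ Δ : List Sort

  -- A supply of variables together with the states in which they are
  -- evaluated; a parameter is a variable with the same value in every state.
  record Context v q : Set (suc (v ⊔ q ⊔ ℓ)) where
    field
      Var   : Sort → Set v
      State : Set q
      value : Var s → State → Carrier s

    values-in : State → All Var Γ → All Carrier Γ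
    values-in ω = All.map (λ x → value x ω)

  open Context

  private variable
    K K′ : Context v q

  -- The formula is kept behind the predicate it defines, so that later arguments combine predicates
  -- of states instead of de Bruijn syntax.
  record Definable (K : Context v q) (P : Pred (State K) (suc ℓ)) : Set (suc ℓ ⊔ v ⊔ q) where
    field
      {support} : List Sort
      variables : All (Var K) support
      formula   : Formula L support
      correct   : ∀ ω → (ω ∈ P) ⇔ (M ⊨ formula [ values-in K ω variables ])

  open Definable

  -- Variables go forward and states backward, as for morphisms of Chu spaces; hence `pullback`
  -- precomposes with `onState` and leaves the formula unchanged.
  record _⟶_ (K : Context v q) (K′ : Context p r) : Set (suc ℓ ⊔ v ⊔ q ⊔ p ⊔ r) where
    field
      onVar   : Var K s → Var K′ s
      onState : State K′ → State K
      onValue : ∀ (x : Var K s) ω → value K′ (onVar x) ω ≡ value K x (onState ω)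

  open _⟶_

  pullback : ∀ {P} (h : K ⟶ K′) → Definable K P → Definable K′ (P ∘ onState h)
  pullback {K = K} {K′ = K′} h D = record
    { variables = All.map (onVar h) (variables D)
    ; formula   = formula D
    ; correct   = λ ω → subst (λ ρ → _ ⇔ (M ⊨ formula D [ ρ ]))
        (sym (trans (All.map-∘ (variables D)) (All.map-cong (variables D) (λ x → onValue h x ω))))
        (correct D (onState h ω))
    }

  definable-cong : ∀ {P Q} → (∀ ω → P ω ⇔ Q ω) → Definable K P → Definable K Q
  definable-cong P⇔Q D = record
    { variables = variables D
    ; formula   = formula D
    ; correct   = λ ω → mk⇔ (to (correct D ω) ∘ from (P⇔Q ω)) (to (P⇔Q ω) ∘ from (correct D ω))
    }

  -- A formula sees a state only through the values of its variables. This allows families of tuples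
  -- that agree pointwise to be exchanged.
  definable-ext : ∀ {P ω ω′} → Definable K P → (∀ {s} (x : Var K s) → value K x ω ≡ value K x ω′) →
    P ω → P ω′
  definable-ext {ω = ω} {ω′} D eq = from (correct D ω′) ∘
    subst (λ ρ → M ⊨ formula D [ ρ ]) (All.map-cong (variables D) eq) ∘ to (correct D ω)

  data ExtendVar (V : Sort → Set v) (s : Sort) : Sort → Set (v ⊔ ℓ) where
    new : ExtendVar V s s
    old : V t → ExtendVar V s t

  infixl 5 _▷_

  _▷_ : Context v q → Sort → Context (v ⊔ ℓ) (q ⊔ suc ℓ)
  K ▷ s = record
    { Var   = ExtendVar (Var K) s
    ; State = State K × Carrier s
    ; value = λ { new (ω , c) → c ; (old x) (ω , c) → value K x ω }
    }

  weaken : K ⟶ (K ▷ s)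
  weaken = record { onVar = old ; onState = proj₁ ; onValue = λ x ω → refl }

  extend : K ⟶ K′ → (K ▷ s) ⟶ (K′ ▷ s)
  extend h = record
    { onVar   = λ { new → new ; (old x) → old (onVar h x) }
    ; onState = λ (ω , c) → onState h ω , c
    ; onValue = λ { new ω → refl ; (old x) (ω , c) → onValue h x ω }
    }

  -- A quantifier binds position zero of the context, so the new variable has
  -- to occur there and nowhere else.
  record Bound (K : Context v q) (s : Sort) (P : Pred (State (K ▷ s)) (suc ℓ)) : Set (suc ℓ ⊔ v ⊔ q) where
    field
      {support} : List Sort
      variables : All (Var K) support
      formula   : Formula L (s ∷ support)
      correct   : ∀ ω c → P (ω , c) ⇔ (M ⊨ formula [ c ∷ values-in K ω variables ])

  -- All occurrences of `new` are merged into position zero and the old variables are gathered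
  -- behind it; the formula is renamed along the resulting map `f` of positions.
  bind : ∀ {P} → Definable (K ▷ s) P → Bound K s P
  bind {K = K} {s = s} D with partition (variables D)
    where
    partition : (xs : All (ExtendVar (Var K) s) Γ) →
      Σ[ Δ ∈ List Sort ] Σ[ ys ∈ All (Var K) Δ ] Σ[ f ∈ (∀ {t} → t ∈ˡ Γ → t ∈ˡ s ∷ Δ) ]
        (∀ ω c {t} (x : t ∈ˡ Γ) → All.lookup (c ∷ values-in K ω ys) (f x) ≡
                                  All.lookup (values-in (K ▷ s) (ω , c) xs) x)
    partition [] = [] , [] , (λ ()) , λ _ _ ()
    partition (new ∷ xs) with Δ , ys , f , eq ← partition xs =
      Δ , ys , (λ { (here refl) → here refl ; (there x) → f x }) ,
      λ { ω c (here refl) → refl ; ω c (there x) → eq ω c x }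
    partition (old y ∷ xs) with Δ , ys , f , eq ← partition xs =
      _ , y ∷ ys ,
      (λ { (here refl) → there (here refl) ; (there x) → insertVar (s ∷ []) (f x) }) ,
      λ { ω c (here refl) → refl
        ; ω c (there x)   → trans (lookup-insertVar (c ∷ []) (values-in K ω ys) _ (f x)) (eq ω c x) }
  ... | Δ , ys , f , eq = record
    { variables = ys
    ; formula   = rename f (formula D)
    ; correct   = λ ω c → mk⇔
        (from (⊨-rename (eq ω c) (formula D)) ∘ to (correct D (ω , c)))
        (from (correct D (ω , c)) ∘ to (⊨-rename (eq ω c) (formula D)))
    }

  definable-∀ : ∀ {P} → Definable (K ▷ s) P → Definable K (λ ω → ∀ c → P (ω , c))
  definable-∀ D = record
    { variables = Bound.variables (bind D)
    ; formula   = all _ (Bound.formula (bind D))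
    ; correct   = λ ω → mk⇔
        (λ h c → to (Bound.correct (bind D) ω c) (h c))
        (λ h c → from (Bound.correct (bind D) ω c) (h c))
    }

  definable-⊥ : Definable K (λ _ → ⊥)
  definable-⊥ = record { variables = [] ; formula = ff ; correct = λ _ → mk⇔ id id }

  definable-≡ : (x y : Var K s) → Definable K (λ ω → value K x ω ≡ value K y ω)
  definable-≡ x y = record
    { variables = x ∷ y ∷ []
    ; formula   = var (here refl) == var (there (here refl))
    ; correct   = λ _ → mk⇔ id id
    }

  definable-→ : ∀ {P Q} → Definable K P → Definable K Q → Definable K (λ ω → P ω → Q ω)
  definable-→ {K = K} D E = record
    { variables = All.++⁺ (variables D) (variables E)
    ; formula   = rename ∈-++⁺ˡ (formula D) ⇒ rename (∈-++⁺ʳ (support D)) (formula E)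
    ; correct   = λ ω → mk⇔
        (λ h → from (right ω) ∘ to (correct E ω) ∘ h ∘ from (correct D ω) ∘ to (left ω))
        (λ h → from (correct E ω) ∘ to (right ω) ∘ h ∘ from (left ω) ∘ to (correct D ω))
    }
    where
    values-++ : ∀ ω → values-in K ω (All.++⁺ (variables D) (variables E)) ≡
      All.++⁺ (values-in K ω (variables D)) (values-in K ω (variables E))
    values-++ ω = map-++⁺ (λ x → value K x ω) (variables D) (variables E)

    left : ∀ ω → _
    left ω = ⊨-rename {M = M} {ρ′ = values-in K ω (All.++⁺ (variables D) (variables E))}
      (λ x → trans (cong (λ ρ → All.lookup ρ (∈-++⁺ˡ x)) (values-++ ω))
                   (lookup-∈-++⁺ˡ (values-in K ω (variables D)) _ x))
      (formula D)

    right : ∀ ω → _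
    right ω = ⊨-rename {M = M} {ρ′ = values-in K ω (All.++⁺ (variables D) (variables E))}
      (λ x → trans (cong (λ ρ → All.lookup ρ (∈-++⁺ʳ (support D) x)) (values-++ ω))
                   (lookup-∈-++⁺ʳ (values-in K ω (variables D)) _ x))
      (formula E)

  definable-¬ : ∀ {P} → Definable K P → Definable K (λ ω → ¬ P ω)
  definable-¬ D = definable-cong (λ _ → mk⇔ (λ h → lower ∘ h) (λ h → lift ∘ h))
    (definable-→ D definable-⊥)

  -- With `⇒`, `ff` and `all` as the only connectives, a conjunction is written as a negated
  -- implication, and excluded middle recovers the pair. The existential quantifier below is treated
  -- likewise.
  definable-× : ∀ {P Q} → Definable K P → Definable K Q → Definable K (λ ω → P ω × Q ω)
  definable-× D E = definable-cong
    (λ _ → mk⇔ (λ h → decidable-stable em λ n → h λ z w → n (z , w)) (λ (z , w) h → h z w))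
    (definable-¬ (definable-→ D (definable-¬ E)))

  definable-∃ : ∀ {P} → Definable (K ▷ s) P → Definable K (λ ω → ∃[ c ] P (ω , c))
  definable-∃ D = definable-cong
    (λ _ → mk⇔ (λ h → decidable-stable em λ n → h λ c z → n (c , z)) (λ (c , z) h → h c z))
    (definable-¬ (definable-∀ (definable-¬ D)))

  AtMost : {C : Set a} → ℕ → Pred C p → Set (a ⊔ p)
  AtMost k P = Σ[ ys ∈ List _ ] length ys ℕ.≤ k × P ⊆ (_∈ˡ ys)

  -- Counting is first order by recursion: there are at most `suc k` solutions exactly when some `x`
  -- exists such that at most `k` solutions differ from it.
  definable-AtMost : ∀ k {P} → Definable (K ▷ s) P → Definable K (λ ω → AtMost k (λ c → P (ω , c)))
  definable-AtMost zero D = definable-cong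
    (λ _ → mk⇔ (λ h → [] , z≤n , λ {c} z → contradiction z (h c))
               (λ { ([] , _ , ⊆ys) c z → contradiction (⊆ys z) λ () }))
    (definable-∀ (definable-¬ D))
  definable-AtMost {s = s} (ℕ.suc k) {P} D = definable-cong (λ ω → mk⇔ (insert ω) (remove ω))
    (definable-∃ (definable-AtMost k
      (definable-× (pullback (extend weaken) D) (definable-¬ (definable-≡ new (old new))))))
    where
    insert : ∀ ω → (∃[ x ] AtMost k (λ c → P (ω , c) × c ≢ x)) → AtMost (ℕ.suc k) (λ c → P (ω , c))
    insert ω (x , ys , ys≤k , ⊆ys) = x ∷ ys , s≤s ys≤k , λ {c} z → case-≡ c z em
      where
      case-≡ : ∀ c → P (ω , c) → Dec (c ≡ x) → c ∈ˡ x ∷ ys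
      case-≡ c z (yes c≡x) = here c≡x
      case-≡ c z (no c≢x)  = there (⊆ys (z , c≢x))

    remove : ∀ ω → AtMost (ℕ.suc k) (λ c → P (ω , c)) → ∃[ x ] AtMost k (λ c → P (ω , c) × c ≢ x)
    -- There is nothing to remove here, so `x` may be any point, and the sort has one.
    remove ω ([] , _ , ⊆ys) = inhabited s , [] , z≤n , λ (z , _) → ⊆ys z
    remove ω (x ∷ ys , s≤s ys≤k , ⊆ys) = x , ys , ys≤k , λ (z , c≢x) → tail c≢x (⊆ys z)
      where
      tail : ∀ {c} → c ≢ x → c ∈ˡ x ∷ ys → c ∈ˡ ys
      tail c≢x (here c≡x) = contradiction c≡x c≢x
      tail c≢x (there c∈) = c∈

  AtMost⇒Finite : ∀ {k} {P : Pred C p} → AtMost k P → Finite P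
  AtMost⇒Finite (ys , _ , ⊆ys) = ys , ⊆ys

  Finite⇒AtMost : {P : Pred C p} ((ys , _) : Finite P) → AtMost (length ys) P
  Finite⇒AtMost (ys , ⊆ys) = ys , ℕ.≤-refl , ⊆ys

  -- Filtering out `y` shortens the list by at least one and loses no element of `Q`. This is the
  -- descent in `stabilise`.
  AtMost-remove : ∀ {k} {P Q : Pred (Carrier s) p} {y} → Q ⊆ P → y ∈ P → ¬ y ∈ Q →
    AtMost (ℕ.suc k) P → AtMost k Q
  AtMost-remove {Q = Q} {y} Q⊆P y∈P y∉Q (ys , ys≤ , ⊆ys) =
    filter ≢y? ys ,
    s≤s⁻¹ (ℕ.≤-trans (List.filter-notAll ≢y? ys (Any.map (λ y≡z ≢y → ≢y (sym y≡z)) (⊆ys y∈P))) ys≤) ,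
    λ z → ∈-filter⁺ ≢y? (⊆ys (Q⊆P z)) λ eq → y∉Q (subst Q eq z)
    where
    ≢y? : ∀ z → Dec (z ≢ y)
    ≢y? z = ¬? em

  -- Algebraic elements

  ∘-⟶ : {K₁ : Context v q} {K₂ : Context p r} {K₃ : Context a x} → K₁ ⟶ K₂ → K₂ ⟶ K₃ → K₁ ⟶ K₃
  ∘-⟶ f g = record
    { onVar   = onVar g ∘ onVar f
    ; onState = onState f ∘ onState g
    ; onValue = λ x ω → trans (onValue g (onVar f x) ω) (onValue f x (onState g ω))
    }

  id-⟶ : K ⟶ K
  id-⟶ = record { onVar = id ; onState = id ; onValue = λ _ _ → refl }

  record Algebraic (K : Context v q) (ω : State K) (d : Carrier s) : Set (suc (suc ℓ) ⊔ v ⊔ q) where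
    field
      {solution} : Pred (State (K ▷ s)) (suc ℓ)
      definable  : Definable (K ▷ s) solution
      holds      : (ω , d) ∈ solution
      finite     : Finite (λ c → (ω , c) ∈ solution)

  open Algebraic

  algebraic-pullback : (h : K ⟶ K′) {ω : State K′} {d : Carrier s} →
    Algebraic K (onState h ω) d → Algebraic K′ ω d
  algebraic-pullback h D = record
    { definable = pullback (extend h) (definable D)
    ; holds     = holds D
    ; finite    = finite D
    }

  -- Excluded middle decides for each `z` whether its fibre is small; only the small fibres
  -- contribute to the list.
  finite-union : ∀ {k} {R : Carrier s → Pred (Carrier t) (suc ℓ)} (zs : List (Carrier s)) →
    Σ[ ys ∈ List (Carrier t) ] (∀ {z y} → z ∈ˡ zs → AtMost k (R z) → y ∈ R z → y ∈ˡ ys)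
  finite-union [] = [] , λ ()
  finite-union {k = k} {R} (z ∷ zs) with finite-union {k = k} {R} zs | em {P = AtMost k (R z)}
  ... | ys , ⊆ys | yes (xs , _ , ⊆xs) = xs ++ ys , λ
    { (here refl) _ y∈ → ∈-++⁺ˡ (⊆xs y∈)
    ; (there z∈) m y∈  → ∈-++⁺ʳ xs (⊆ys z∈ m y∈)
    }
  ... | ys , ⊆ys | no ¬m = ys , λ
    { (here refl) m y∈ → contradiction m ¬m
    ; (there z∈) m y∈  → ⊆ys z∈ m y∈
    }

  -- Once `c` is quantified away, the formula for `d` could have infinitely many solutions over some
  -- other `z` in the finite set around `c`. The clause with `k`, a bound valid at `c`, excludes
  -- such `z`, and a finite union of finite sets is left.
  algebraic-trans : {ω : State K} {c : Carrier t} {d : Carrier s} →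
    Algebraic (K ▷ t) (ω , c) d → Algebraic K ω c → Algebraic K ω d
  algebraic-trans {K = K} {t} {s} {ω} {c} D E = record
    { definable = definable-∃ (definable-× (pullback (extend weaken) (definable E))
        (definable-× (pullback exchange (definable D))
          (definable-AtMost k (pullback (extend (extend weaken)) (definable D)))))
    ; holds     = c , holds E , holds D , Finite⇒AtMost (finite D)
    ; finite    = let ys , ⊆ys = finite-union {k = k} (proj₁ (finite E)) in
        ys , λ (z , z∈ , y∈ , m) → ⊆ys (proj₂ (finite E) z∈) m y∈
    }
    where
    k = length (proj₁ (finite D))

    exchange : (K ▷ t ▷ s) ⟶ (K ▷ s ▷ t)
    exchange = record
      { onVar   = λ { new → old new ; (old new) → new ; (old (old x)) → old (old x) }
      ; onState = λ ((ω , c) , d) → (ω , d) , c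
      ; onValue = λ { new _ → refl ; (old new) _ → refl ; (old (old x)) _ → refl }
      }

  infixl 5 _▷▷_ _▸▸_

  _▷▷_ : Context (suc ℓ) (suc ℓ) → List Sort → Context (suc ℓ) (suc ℓ)
  K ▷▷ []      = K
  K ▷▷ (s ∷ Δ) = K ▷▷ Δ ▷ s

  private variable
    K₀ : Context (suc ℓ) (suc ℓ)

  _▸▸_ : State K₀ → All Carrier Δ → State (K₀ ▷▷ Δ)
  ω ▸▸ []      = ω
  ω ▸▸ (c ∷ ρ) = (ω ▸▸ ρ) , c

  latest : ∀ Δ → All (Var (K₀ ▷▷ Δ)) Δ
  latest []      = []
  latest (s ∷ Δ) = new ∷ All.map old (latest Δ)

  values-latest : {ω : State K₀} (ρ : All Carrier Δ) →
    values-in (K₀ ▷▷ Δ) (_▸▸_ {K₀ = K₀} ω ρ) (latest Δ) ≡ ρ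
  values-latest []                        = refl
  values-latest {Δ = _ ∷ Δ} {ω = ω} (c ∷ ρ) =
    cong (c ∷_) (trans (All.map-∘ (latest Δ)) (values-latest ρ))

  weakens : ∀ Δ → K₀ ⟶ (K₀ ▷▷ Δ)
  weakens []      = id-⟶
  weakens (s ∷ Δ) = ∘-⟶ (weakens Δ) weaken

  weakens-▸▸ : {ω : State K₀} (ρ : All Carrier Δ) →
    onState (weakens Δ) (_▸▸_ {K₀ = K₀} ω ρ) ≡ ω
  weakens-▸▸ []      = refl
  weakens-▸▸ (c ∷ ρ) = weakens-▸▸ ρ

  algebraic-weakens : {ω : State K₀} {d : Carrier s} (ρ : All Carrier Δ) →
    Algebraic K₀ ω d → Algebraic (K₀ ▷▷ Δ) (ω ▸▸ ρ) d
  algebraic-weakens {Δ = Δ} ρ D = algebraic-pullback (weakens Δ)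
    (subst (λ ω → Algebraic _ ω _) (sym (weakens-▸▸ ρ)) D)

  -- The closure operator `acl`.

  Constants : Pred (Element M) p → Context (suc ℓ ⊔ p) (suc ℓ)
  Constants A = record
    { Var   = λ s → Σ[ c ∈ Carrier s ] (s , c) ∈ A
    ; State = ⊤
    ; value = λ x _ → proj₁ x
    }

  private variable
    D D′ : Pred (Element M) p

  acl⇒algebraic : {d : Carrier s} → (s , d) ∈ acl M D → Algebraic (Constants D) tt d
  acl⇒algebraic {s = s} {D = D} {d} (Δ , e , φ , sat , fin) = record
    { definable = record
      { variables = new ∷ All.map old e
      ; formula   = φ
      ; correct   = λ (_ , c) → subst (λ ρ → (M ⊨ φ [ c ∷ values M e ]) ⇔ (M ⊨ φ [ c ∷ ρ ]))
          (sym (All.map-∘ e)) (mk⇔ id id)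
      }
    ; holds     = sat
    ; finite    = fin
    }

  algebraic⇒acl : {d : Carrier s} → Algebraic (Constants D) tt d → (s , d) ∈ acl M D
  algebraic⇒acl A with bind (definable A)
  ... | B = Bound.support B , Bound.variables B , Bound.formula B ,
    to (Bound.correct B tt _) (holds A) ,
    proj₁ (finite A) , proj₂ (finite A) ∘ from (Bound.correct B tt _)

  constants-mono : D ⊆ D′ → Constants D ⟶ Constants D′
  constants-mono D⊆D′ = record
    { onVar = λ (c , c∈) → c , D⊆D′ c∈ ; onState = id ; onValue = λ _ _ → refl }

  acl-mono : D ⊆ D′ → acl M D ⊆ acl M D′
  acl-mono D⊆D′ = algebraic⇒acl ∘ algebraic-pullback (constants-mono D⊆D′) ∘ acl⇒algebraic

  acl-extensive : D ⊆ acl M D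
  acl-extensive {D = D} {s , d} d∈D = algebraic⇒acl record
    { definable = definable-≡ new (old (d , d∈D))
    ; holds     = refl
    ; finite    = d ∷ [] , here
    }

  -- The head of the list is the outermost parameter, so it is eliminated first; it is still
  -- algebraic over the base enlarged by the tail.
  algebraic-over-algebraic : {ω : State K₀} {d : Carrier s}
    (ρ : All (λ t → Σ[ c ∈ Carrier t ] Algebraic K₀ ω c) Δ) →
    Algebraic (K₀ ▷▷ Δ) (ω ▸▸ All.map proj₁ ρ) d → Algebraic K₀ ω d
  algebraic-over-algebraic []             A = A
  algebraic-over-algebraic ((c , C) ∷ ρ) A =
    algebraic-over-algebraic ρ (algebraic-trans A (algebraic-weakens (All.map proj₁ ρ) C))

  acl-idem : {D : Pred (Element M) (suc ℓ)} → acl M (acl M D) ⊆ acl M D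
  acl-idem {D} {s , d} (Δ , e , φ , sat , fin) =
    algebraic⇒acl (algebraic-over-algebraic e′ (subst (λ ρ → Algebraic (Constants D ▷▷ Δ) (tt ▸▸ ρ) d)
      (sym (All.map-∘ e)) record
      { definable = record
        { variables = new ∷ All.map old (latest Δ) ; formula = φ ; correct = λ _ → mk⇔ id id }
      ; holds     = from (sat-values d) sat
      ; finite    = proj₁ fin , λ {c} → proj₂ fin ∘ to (sat-values c)
      }))
    where
    e′ : All (λ t → Σ[ c ∈ Carrier t ] Algebraic (Constants D) tt c) Δ
    e′ = All.map (λ (c , c∈) → c , acl⇒algebraic c∈) e

    sat-values : ∀ c →
      (M ⊨ φ [ c ∷ values-in (Constants D ▷▷ Δ ▷ s) (_▸▸_ {K₀ = Constants D} tt (values M e) , c)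
                             (All.map old (latest Δ)) ]) ⇔
      (M ⊨ φ [ c ∷ values M e ])
    sat-values c = subst (λ ρ → (M ⊨ φ [ c ∷ ρ ]) ⇔ (M ⊨ φ [ c ∷ values M e ]))
      (sym (trans (All.map-∘ (latest Δ)) (values-latest (values M e)))) (mk⇔ id id)

  -- Sequences of indiscernibles

  module Sequences {α : Set ℓ} (σ : α → Sort) where

    private variable
      P : Pred A p

    data SequenceVar (X : Set x) (V : Sort → Set v) : Sort → Set (x ⊔ v ⊔ ℓ) where
      entry : X → (i : α) → SequenceVar X V (σ i)
      param : V s → SequenceVar X V s

    -- The tuples belong to the state and are not constants, so one definable predicate can be
    -- evaluated at different places of a sequence.
    Seq : Set x → Context v q → Context (x ⊔ v ⊔ ℓ) (x ⊔ suc ℓ ⊔ q)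
    Seq X K = record
      { Var   = SequenceVar X (Var K)
      ; State = (X → Tuple M σ) × State K
      ; value = λ { (entry y i) (C , _) → C y i ; (param z) (_ , ω) → value K z ω }
      }

    mapSeq : (Y → X) → K ⟶ K′ → Seq Y K ⟶ Seq X K′
    mapSeq f h = record
      { onVar   = λ { (entry y i) → entry (f y) i ; (param z) → param (onVar h z) }
      ; onState = λ (C , ω) → C ∘ f , onState h ω
      ; onValue = λ { (entry y i) _ → refl ; (param z) (_ , ω) → onValue h z ω }
      }

    reindex : (Y → X) → Seq Y K ⟶ Seq X K
    reindex f = mapSeq f id-⟶

    params : K ⟶ Seq X K
    params = record { onVar = param ; onState = proj₂ ; onValue = λ _ _ → refl }

    ▷-outward : Seq X (K ▷ s) ⟶ (Seq X K ▷ s)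
    ▷-outward = record
      { onVar   = λ { (entry y i) → old (entry y i) ; (param new) → new ; (param (old z)) → old (param z) }
      ; onState = λ ((C , ω) , c) → C , (ω , c)
      ; onValue = λ { (entry y i) _ → refl ; (param new) _ → refl ; (param (old z)) _ → refl }
      }

    ▷-inward : (Seq X K ▷ s) ⟶ Seq X (K ▷ s)
    ▷-inward = record
      { onVar   = λ { new → param new ; (old (entry y i)) → entry y i ; (old (param z)) → param (old z) }
      ; onState = λ (C , (ω , c)) → (C , ω) , c
      ; onValue = λ { new _ → refl ; (old (entry y i)) _ → refl ; (old (param z)) _ → refl }
      }

    coordinates : {V : Sort → Set v} {Z : Set ℓ} {τ : Z → Sort} →
      (∀ z → V (τ z)) → (zs : List Z) → All V (map τ zs)
    coordinates f zs = All.map⁺ (All.universal f zs)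

    values-coordinates : {Z : Set ℓ} {τ : Z → Sort} (K : Context v q) (ω : State K)
      (f : ∀ z → Var K (τ z)) (zs : List Z) →
      values-in K ω (coordinates {V = Var K} {τ = τ} f zs) ≡ restrict M {σ = τ} (λ z → value K (f z) ω) zs
    values-coordinates K ω f []       = refl
    values-coordinates K ω f (z ∷ zs) = cong (value K (f z) ω ∷_) (values-coordinates K ω f zs)

    -- A formula mentions finitely many entries. The list `xs` gets one item for each mention, so an
    -- index may occur in it repeatedly.
    finite-support : Definable (Seq X K) P →
      Σ[ xs ∈ List X ] Σ[ Q ∈ Pred (State (Seq (Fin (length xs)) K)) (suc ℓ) ]
        Definable (Seq (Fin (length xs)) K) Q ×
        (∀ C ω → P (C , ω) ⇔ Q (C ∘ lookup xs , ω))
    finite-support {X = X} {K = K} E with factor (variables E)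
      where
      factor : (ys : All (SequenceVar X (Var K)) Γ) →
        Σ[ xs ∈ List X ] Σ[ zs ∈ All (SequenceVar (Fin (length xs)) (Var K)) Γ ]
          (∀ C ω → values-in (Seq X K) (C , ω) ys ≡ values-in (Seq _ K) (C ∘ lookup xs , ω) zs)
      factor [] = [] , [] , λ _ _ → refl
      factor (entry x i ∷ ys) with xs , zs , eq ← factor ys =
        x ∷ xs , entry Fin.zero i ∷ All.map (onVar shift) zs , λ C ω →
          cong (C x i ∷_) (trans (eq C ω) (sym (trans (All.map-∘ zs)
            (All.map-cong zs λ z → onValue shift z (C ∘ lookup (x ∷ xs) , ω)))))
        where
        shift : Seq (Fin (length xs)) K ⟶ Seq (Fin (ℕ.suc (length xs))) K
        shift = reindex Fin.suc
      factor (param z ∷ ys) with xs , zs , eq ← factor ys =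
        xs , param z ∷ zs , λ C ω → cong (value K z ω ∷_) (eq C ω)
    ... | xs , zs , eq = xs , _ , record
      { variables = zs ; formula = formula E ; correct = λ _ → mk⇔ id id } ,
      λ C ω → subst (λ ρ → _ ⇔ (M ⊨ formula E [ ρ ])) (eq C ω) (correct E (C , ω))

    module _ (𝐚 : Sequence M σ) where
      open Sequence 𝐚

      -- The semantic form of `IndiscernibleOver`, with the parameters given by a context and a
      -- state. An implication suffices because `c` and `c′` may be exchanged.
      Indisc : (K : Context v q) → State K → Set (suc (suc ℓ) ⊔ v ⊔ q)
      Indisc K ω = ∀ {n} (c c′ : Fin n → Index) →
        c Preserves Fin._<_ ⟶ _<_ → c′ Preserves Fin._<_ ⟶ _<_ →
        ∀ {P} → Definable (Seq (Fin n) K) P → P (tuple ∘ c , ω) → P (tuple ∘ c′ , ω)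

      -- `SameTypeOver` expects the entries of the sequence before the parameters, so `collect`
      -- separates the two kinds of variables and the formula is renamed accordingly.
      indiscernibleOver⇒indisc : IndiscernibleOver M σ D 𝐚 → Indisc (Constants D) tt
      indiscernibleOver⇒indisc {D = D} ind {n} c c′ c↑ c′↑ E with collect (variables E)
        where
        environment : (zs : List (Fin n × α)) → ParametersIn M D Δ → (Fin n → Tuple M σ) →
          All Carrier (map (σ ∘ proj₂) zs ++ Δ)
        environment zs e C = All.++⁺ (restrict M {σ = σ ∘ proj₂} (λ (k , i) → C k i) zs) (values M e)

        collect : (ys : All (SequenceVar (Fin n) (Var (Constants D))) Γ) →
          Σ[ zs ∈ List (Fin n × α) ] Σ[ Δ ∈ List Sort ] Σ[ e ∈ ParametersIn M D Δ ]
          Σ[ f ∈ (∀ {t} → t ∈ˡ Γ → t ∈ˡ map (σ ∘ proj₂) zs ++ Δ) ]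
            (∀ C {t} (y : t ∈ˡ Γ) → All.lookup (environment zs e C) (f y) ≡
              All.lookup (values-in (Seq (Fin n) (Constants D)) (C , tt) ys) y)
        collect [] = [] , [] , [] , (λ ()) , λ _ ()
        collect (entry k i ∷ ys) with zs , Δ , e , f , eq ← collect ys =
          (k , i) ∷ zs , Δ , e ,
          (λ { (here refl) → here refl ; (there y) → there (f y) }) ,
          λ { C (here refl) → refl ; C (there y) → eq C y }
        collect (param (d , d∈D) ∷ ys) with zs , Δ , e , f , eq ← collect ys =
          zs , _ , (d , d∈D) ∷ e ,
          (λ { (here refl) → ∈-++⁺ʳ (map (σ ∘ proj₂) zs) (here refl)
             ; (there y)   → insertVar (map (σ ∘ proj₂) zs) (f y) }) ,
          λ { C (here refl) → lookup-∈-++⁺ʳ (restrict M {σ = σ ∘ proj₂} (λ (k , i) → C k i) zs) _ (here refl)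
            ; C (there y)   → trans
                (lookup-insertVar (restrict M {σ = σ ∘ proj₂} (λ (k , i) → C k i) zs) (values M e) d (f y))
                (eq C y) }
      ... | zs , Δ , e , f , eq =
        from (correct E (tuple ∘ c′ , tt)) ∘ to (⊨-rename (eq (tuple ∘ c′)) (formula E)) ∘
        to (ind n c c′ c↑ c′↑ zs Δ (rename f (formula E)) e) ∘
        from (⊨-rename (eq (tuple ∘ c)) (formula E)) ∘ to (correct E (tuple ∘ c , tt))

      module _ {ω : State K} (ind : Indisc K ω) where

        -- After `finite-support` the tuple is finite. Enumerating it makes both tuples factor
        -- through the same `position`: `u′` repeats where `u` does and increases along `select`,
        -- because the pattern of `u` is preserved. What remains is the case of increasing tuples.
        transfer : (u u′ : X → Index) → u ⟨ _<_ ⟩≲⟨ _<_ ⟩ u′ →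
          Definable (Seq X K) P → P (tuple ∘ u , ω) → P (tuple ∘ u′ , ω)
        transfer u u′ u≲u′ E Pu with xs , Q , E′ , P⇔Q ← finite-support E =
          from (P⇔Q (tuple ∘ u′) ω) (back (ind _ _ mono mono′ (pullback (reindex position) E′)
            (forth (to (P⇔Q (tuple ∘ u) ω) Pu))))
          where
          w w′ : Fin (length xs) → Index
          w  = u ∘ lookup xs
          w′ = u′ ∘ lookup xs

          w≲w′ : w ⟨ _<_ ⟩≲⟨ _<_ ⟩ w′
          w≲w′ = ≲-∘ (lookup xs) u≲u′
          open _⟨_⟩≲⟨_⟩_ w≲w′
          open Sorting isStrictTotalOrder
          open Enumeration (enumerate (finite-Fin _) w)

          mono′ : (w′ ∘ select) Preserves Fin._<_ ⟶ _<_
          mono′ i<j = lt _ _ (mono i<j)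

          forth : Q (tuple ∘ w , ω) → Q (tuple ∘ w ∘ select ∘ position , ω)
          forth = definable-ext E′ λ
            { (entry k i) → cong (λ j → tuple j i) (factors k) ; (param z) → refl }

          back : Q (tuple ∘ w′ ∘ select ∘ position , ω) → Q (tuple ∘ w′ , ω)
          back = definable-ext E′ λ
            { (entry k i) → cong (λ j → tuple j i) (sym (eq _ _ (factors k))) ; (param z) → refl }

    em↓ : ExcludedMiddle ℓ
    em↓ {Q} = map′ lower lift (em {Lift (suc ℓ) Q})

    -- Adjoining parameters while preserving indiscernibility.

    module _ (𝐚 : Sequence M σ) where
      open Sequence 𝐚
      open Sorting isStrictTotalOrder

      private
        _≲_ : (X → Index) → (X → Index) → Set _
        u ≲ v = u ⟨ _<_ ⟩≲⟨ _<_ ⟩ v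

      -- The tuple `v` has the order pattern of `position`, and any increasing map out of
      -- `Fin size`, into whatever order, copies that pattern.
      ≲-copy : {v : X → Index} (E : Enumeration v)
        {B : Set p} {_⊏_ : Rel B q} {m : Fin (Enumeration.size E) → B} → m Preserves Fin._<_ ⟶ _⊏_ →
        v ⟨ _<_ ⟩≲⟨ _⊏_ ⟩ (m ∘ Enumeration.position E)
      ≲-copy E m↑ = ≲-trans (≲-≗ factors)
        (≲-trans (≲-sym Fin.<-isStrictTotalOrder isStrictTotalOrder (≲-monotone mono position))
          (≲-monotone m↑ position))
        where open Enumeration E

      -- Copy i, i′ and k₀ into each of 2^|χ| + 1 successive blocks of a chain. Two
      -- blocks give the same truth pattern on the solutions of χ; as i and i′ are
      -- ordered alike, each of their copies in the first of these blocks agrees with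
      -- the copy of i in the second, hence they agree with each other.
      module _ {K : Context v q} {ω : State K} (ind : Indisc 𝐚 K ω)
        {X : Set} (finX : Finite {A = X} U) (k₀ : X → Index)
        {χ : Pred (State (Seq X K ▷ s)) (suc ℓ)} (χ-definable : Definable (Seq X K ▷ s) χ)
        (χ-finite : Finite (λ y → χ ((tuple ∘ k₀ , ω) , y)))
        (χ-constant : ∀ k k′ → k₀ ≲ k → k₀ ≲ k′ → ∀ {y} →
          χ ((tuple ∘ k , ω) , y) → χ ((tuple ∘ k′ , ω) , y))
        {d : Carrier s} (d∈χ : χ ((tuple ∘ k₀ , ω) , d))
        where

        private
          ys : List (Carrier s)
          ys = proj₁ χ-finite

        indisc-▷ : Indisc 𝐚 (K ▷ s) (ω , d)
        indisc-▷ {n} i i′ i↑ i′↑ {P} E Pi = proj₁ (Q-goal d d∈χ) Pi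
          where
          Z : Set
          Z = Fin n ⊎ (Fin n ⊎ X)

          tuples : Z → Index
          tuples = [ i , [ i′ , k₀ ]′ ]′

          enumeration : Enumeration tuples
          enumeration = enumerate (finite-⊎ (finite-Fin n) (finite-⊎ (finite-Fin n) finX)) tuples
          open Enumeration enumeration

          count : ℕ
          count = ℕ.suc (2 ℕ.^ length ys)

          open Blocks (blocks em↓ infinite count size)
            renaming (block to blockᶠ; block-mono to blockᶠ-mono; block-< to blockᶠ-<)

          block : Fin count → Z → Index
          block t = blockᶠ t ∘ position

          block-< : ∀ {s t} → s Fin.< t → ∀ x y → block s x < block t y
          block-< s<t x y = blockᶠ-< s<t (position x) (position y)

          tuples≲block : ∀ t → tuples ≲ block t
          tuples≲block t = ≲-copy enumeration (blockᶠ-mono t)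

          block-χ : ∀ s t {y} → χ ((tuple ∘ block s ∘ inj₂ ∘ inj₂ , ω) , y) →
            χ ((tuple ∘ block t ∘ inj₂ ∘ inj₂ , ω) , y)
          block-χ s t = χ-constant _ _
            (≲-∘ (inj₂ ∘ inj₂) (tuples≲block s)) (≲-∘ (inj₂ ∘ inj₂) (tuples≲block t))

          χ⊆ys : ∀ t {y} → χ ((tuple ∘ block t ∘ inj₂ ∘ inj₂ , ω) , y) → y ∈ˡ ys
          χ⊆ys t = proj₂ χ-finite ∘
            χ-constant _ _ (≲-∘ (inj₂ ∘ inj₂) (tuples≲block t)) (≲-≗ λ _ → refl)

          holds-in : Fin count → Carrier s → Set (suc ℓ)
          holds-in t y = P (tuple ∘ block t ∘ inj₁ , (ω , y))

          bit : {Q : Set (suc ℓ)} → Dec Q → Fin 2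
          bit (yes _) = Fin.zero
          bit (no _)  = Fin.suc Fin.zero

          bit-injective : {Q R : Set (suc ℓ)} {Q? : Dec Q} {R? : Dec R} → bit Q? ≡ bit R? → Q → R
          bit-injective {R? = yes r}             _ _ = r
          bit-injective {Q? = yes _} {R? = no _} ()
          bit-injective {Q? = no ¬q} {R? = no _} _ q = contradiction q ¬q

          truth : Fin count → Fin (length ys) → Fin 2
          truth t j = bit (em {holds-in t (lookup ys j)})

          collision : Σ[ s ∈ Fin count ] Σ[ t ∈ Fin count ] s Fin.< t × funToFin (truth s) ≡ funToFin (truth t)
          collision = pigeonhole (ℕ.n<1+n _) (funToFin ∘ truth)

          b₁ b₂ : Fin count
          b₁ = proj₁ collision
          b₂ = proj₁ (proj₂ collision)

          b₁<b₂ : b₁ Fin.< b₂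
          b₁<b₂ = proj₁ (proj₂ (proj₂ collision))

          truth-≡ : ∀ j → truth b₁ j ≡ truth b₂ j
          truth-≡ j = trans (sym (finToFun-funToFin (truth b₁) j))
            (trans (cong (λ f → finToFun f j) (proj₂ (proj₂ (proj₂ collision))))
              (finToFun-funToFin (truth b₂) j))

          same : ∀ {y} → y ∈ˡ ys → (holds-in b₁ y → holds-in b₂ y) × (holds-in b₂ y → holds-in b₁ y)
          same y∈ = subst (λ y → (holds-in b₁ y → holds-in b₂ y) × (holds-in b₂ y → holds-in b₁ y))
            (sym (lookup-index y∈))
            (bit-injective (truth-≡ (Any.index y∈)) , bit-injective (sym (truth-≡ (Any.index y∈))))

          -- Quantifying over all solutions of `χ` eliminates `d`: the predicate is definable over
          -- `K` alone, where `ind` can move it.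
          Q : Pred (State (Seq Z K)) (suc ℓ)
          Q (C , ω) = ∀ y → χ ((C ∘ inj₂ ∘ inj₂ , ω) , y) →
            (P (C ∘ inj₁ , (ω , y)) → P (C ∘ inj₂ ∘ inj₁ , (ω , y))) ×
            (P (C ∘ inj₂ ∘ inj₁ , (ω , y)) → P (C ∘ inj₁ , (ω , y)))

          Q-definable : Definable (Seq Z K) Q
          Q-definable = definable-∀ (definable-→
            (pullback (extend (reindex (inj₂ ∘ inj₂))) χ-definable)
            (definable-×
              (definable-→ (at inj₁) (at (inj₂ ∘ inj₁)))
              (definable-→ (at (inj₂ ∘ inj₁)) (at inj₁))))
            where
            at : ∀ f → Definable (Seq Z K ▷ s) (λ ((C , ω) , y) → P (C ∘ f , (ω , y)))
            at f = pullback ▷-outward (pullback (reindex f) E)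

          others : Fin n ⊎ X → Z
          others = [ inj₁ , inj₂ ∘ inj₂ ]′

          i≲ : ∀ (m : Fin n → Index) → m Preserves Fin._<_ ⟶ _<_ → i ≲ m
          i≲ m m↑ = ≲-trans
            (≲-sym Fin.<-isStrictTotalOrder isStrictTotalOrder (≲-monotone i↑ id)) (≲-monotone m↑ id)

          Q-separated : Q (tuple ∘ [ block b₁ ∘ inj₁ , block b₂ ∘ others ]′ , ω)
          Q-separated y y∈χ = same (χ⊆ys b₂ y∈χ)

          -- The first component lies in block `b₁`, entirely below the others in `b₂`, so
          -- exchanging the copy of `i` there for that of `i′` keeps the order pattern.
          Q-separated′ : Q (tuple ∘ [ block b₁ ∘ inj₂ ∘ inj₁ , block b₂ ∘ others ]′ , ω)
          Q-separated′ = transfer 𝐚 ind _ _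
            (≲-⊎ isStrictTotalOrder isStrictTotalOrder
              (≲-trans (≲-sym isStrictTotalOrder isStrictTotalOrder (≲-∘ inj₁ (tuples≲block b₁)))
                (≲-trans (i≲ i′ i′↑) (≲-∘ (inj₂ ∘ inj₁) (tuples≲block b₁))))
              (≲-≗ λ _ → refl)
              (λ x z → inj₁
                (block-< b₁<b₂ (inj₁ x) (others z) , block-< b₁<b₂ (inj₂ (inj₁ x)) (others z))))
            Q-definable Q-separated

          -- The copies of `i` and `i′` in block `b₁` are compared through the copy of `i` in `b₂`;
          -- `block-χ` identifies the solutions at the two blocks.
          Q-block : Q (tuple ∘ block b₁ , ω)
          Q-block y y∈χ =
            proj₂ (Q-separated′ y (block-χ b₁ b₂ y∈χ)) ∘ proj₁ (Q-separated y (block-χ b₁ b₂ y∈χ)) ,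
            proj₂ (Q-separated y (block-χ b₁ b₂ y∈χ)) ∘ proj₁ (Q-separated′ y (block-χ b₁ b₂ y∈χ))

          Q-goal : Q (tuple ∘ tuples , ω)
          Q-goal = transfer 𝐚 ind _ _ (≲-sym isStrictTotalOrder isStrictTotalOrder (tuples≲block b₁))
            Q-definable Q-block

      module _ {ω : State K₀} {D : Pred (Element M) p}
        (step : ∀ {Δ} (ρ : All Carrier Δ) {s} {d : Carrier s} → (s , d) ∈ D →
          Indisc 𝐚 (K₀ ▷▷ Δ) (ω ▸▸ ρ) → Indisc 𝐚 (K₀ ▷▷ Δ ▷ s) (ω ▸▸ ρ , d))
        where

        -- Indiscernibility over each of several elements need not give indiscernibility over all of
        -- them together. Hence `step` has to adjoin an element over an arbitrary list of earlier
        -- parameters.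
        indisc-▷▷ : Indisc 𝐚 K₀ ω → (e : ParametersIn M D Δ) → Indisc 𝐚 (K₀ ▷▷ Δ) (ω ▸▸ values M e)
        indisc-▷▷ ind []               = ind
        indisc-▷▷ ind ((d , d∈D) ∷ e) = step (values M e) d∈D (indisc-▷▷ ind e)

        indisc⇒indiscernibleOver : Indisc 𝐚 K₀ ω → IndiscernibleOver M σ D 𝐚
        indisc⇒indiscernibleOver ind n i j i↑ j↑ zs Δ φ e = mk⇔ (half i j i↑ j↑) (half j i j↑ i↑)
          where
          vars : All (SequenceVar (Fin n) (Var (K₀ ▷▷ Δ))) (map (σ ∘ proj₂) zs ++ Δ)
          vars = All.++⁺ (coordinates {τ = σ ∘ proj₂} (λ (k , x) → entry k x) zs) (All.map param (latest Δ))

          ω⁺ : State (K₀ ▷▷ Δ)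
          ω⁺ = ω ▸▸ values M e

          values-vars : ∀ C → values-in (Seq (Fin n) (K₀ ▷▷ Δ)) (C , ω⁺) vars ≡
            All.++⁺ (restrict M {σ = σ ∘ proj₂} (λ (k , x) → C k x) zs) (values M e)
          values-vars C = trans
            (map-++⁺ (λ x → value (Seq (Fin n) (K₀ ▷▷ Δ)) x (C , ω⁺))
              (coordinates _ zs) (All.map param (latest Δ)))
            (cong₂ All.++⁺
              (values-coordinates (Seq (Fin n) (K₀ ▷▷ Δ)) (C , ω⁺) (λ (k , x) → entry k x) zs)
              (trans (All.map-∘ (latest Δ)) (values-latest (values M e))))

          half : ∀ i j → i Preserves Fin._<_ ⟶ _<_ → j Preserves Fin._<_ ⟶ _<_ →
            M ⊨ φ [ All.++⁺ (restrict M (flatten M σ 𝐚 i) zs) (values M e) ] →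
            M ⊨ φ [ All.++⁺ (restrict M (flatten M σ 𝐚 j) zs) (values M e) ]
          half i j i↑ j↑ h = subst (λ ρ → M ⊨ φ [ ρ ]) (values-vars (tuple ∘ j))
            (indisc-▷▷ ind e i j i↑ j↑ record { variables = vars ; formula = φ ; correct = λ _ → mk⇔ id id }
              (subst (λ ρ → M ⊨ φ [ ρ ]) (sym (values-vars (tuple ∘ i))) h))

      -- The case of `indisc-▷` without sequence entries in `χ`: the solution set is then trivially
      -- the same at all places.
      indisc-▷-algebraic : {K : Context v q} {ω : State K} {d : Carrier s} →
        Indisc 𝐚 K ω → Algebraic K ω d → Indisc 𝐚 (K ▷ s) (ω , d)
      indisc-▷-algebraic ind A = indisc-▷ ind (finite-Fin 0) (λ ())
        (pullback (extend params) (definable A)) (finite A) (λ _ _ _ _ → id) (holds A)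

      indiscernibleOver-acl : {D : Pred (Element M) (suc ℓ)} →
        IndiscernibleOver M σ D 𝐚 → IndiscernibleOver M σ (acl M D) 𝐚
      indiscernibleOver-acl {D} ind = indisc⇒indiscernibleOver {K₀ = Constants D}
        (λ ρ d∈acl ind′ → indisc-▷-algebraic ind′ (algebraic-weakens ρ (acl⇒algebraic d∈acl)))
        (indiscernibleOver⇒indisc 𝐚 ind)

      indiscernibleOver-mono : {D : Pred (Element M) p} {D′ : Pred (Element M) q} →
        D ⊆ D′ → IndiscernibleOver M σ D′ 𝐚 → IndiscernibleOver M σ D 𝐚
      indiscernibleOver-mono {D = D} D⊆D′ ind n i j i↑ j↑ zs Δ φ e =
        subst (λ ρ → (M ⊨ φ [ All.++⁺ (restrict M (flatten M σ 𝐚 i) zs) ρ ]) ⇔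
                     (M ⊨ φ [ All.++⁺ (restrict M (flatten M σ 𝐚 j) zs) ρ ]))
          (All.map-∘ e)
          (ind n i j i↑ j↑ zs Δ φ (All.map (λ (d , d∈D) → d , D⊆D′ d∈D) e))

      -- The algebraic kernel of a single sequence.

      Pure : Set x → Context (suc ℓ ⊔ x) (suc ℓ ⊔ x)
      Pure X = Seq X (Constants (∅ {A = Element M}))

      -- This puts `d` into a finite set attached to the sequence itself: wherever parameters
      -- ordered like `base` are chosen, `χ` has the same solutions. Being a condition on `χ`, it
      -- can be carried to another sequence.
      record Stable (d : Carrier s) : Set (suc (suc ℓ)) where
        field
          {Pos}    : Set
          finPos   : Finite {A = Pos} U
          base     : Pos → Index
          {χ}      : Pred (State (Pure Pos ▷ s)) (suc ℓ)
          formulaχ : Definable (Pure Pos ▷ s) χ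
          member   : χ ((tuple ∘ base , tt) , d)
          bound    : ℕ
          atMost   : ∀ k → base ≲ k → AtMost bound (λ y → χ ((tuple ∘ k , tt) , y))
          constant : ∀ k k′ → base ≲ k → base ≲ k′ → ∀ {y} →
                     χ ((tuple ∘ k , tt) , y) → χ ((tuple ∘ k′ , tt) , y)

      module _ (ind : Indiscernible M σ 𝐚) {d : Carrier s} (ind-d : IndiscernibleOver M σ ｛ s , d ｝ 𝐚) where

        private
          ind∅ : Indisc 𝐚 (Constants ∅) tt
          ind∅ = indiscernibleOver⇒indisc 𝐚 ind

        -- Indiscernibility over `d` enters here: `d` is moved from the place of the solution
        -- variable to that of a parameter.
        member-transfer : {χ : Pred (State (Pure X ▷ s)) (suc ℓ)} → Definable (Pure X ▷ s) χ →
          (k k′ : X → Index) → k ≲ k′ → χ ((tuple ∘ k , tt) , d) → χ ((tuple ∘ k′ , tt) , d)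
        member-transfer E k k′ k≲k′ =
          transfer 𝐚 (indiscernibleOver⇒indisc 𝐚 ind-d) k k′ k≲k′ (pullback d-as-parameter E)
          where
          d-as-parameter : (Pure _ ▷ s) ⟶ Seq _ (Constants ｛ s , d ｝)
          d-as-parameter = record
            { onVar   = λ { new → param (d , refl) ; (old (entry y i)) → entry y i ; (old (param ())) }
            ; onState = λ (C , _) → (C , tt) , d
            ; onValue = λ { new _ → refl ; (old (entry y i)) _ → refl ; (old (param ())) }
            }

        -- If the solution sets at k and k′ differ, the formula χ(k) ∧ χ(k′)
        -- still holds of d and has fewer solutions.
        stabilise : ∀ {X : Set} b (finX : Finite {A = X} U) (k₀ : X → Index)
          {χ : Pred (State (Pure X ▷ s)) (suc ℓ)} → Definable (Pure X ▷ s) χ →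
          χ ((tuple ∘ k₀ , tt) , d) → AtMost b (λ y → χ ((tuple ∘ k₀ , tt) , y)) → Stable d
        stabilise {X} b finX k₀ {χ} E χd few with em {P = Σ[ k ∈ (X → Index) ] Σ[ k′ ∈ (X → Index) ]
          k₀ ≲ k × k₀ ≲ k′ × Σ[ y ∈ Carrier s ] χ ((tuple ∘ k , tt) , y) × ¬ χ ((tuple ∘ k′ , tt) , y)}
        ... | no stable = record
          { finPos   = finX
          ; base     = k₀
          ; formulaχ = E
          ; member   = χd
          ; bound    = b
          ; atMost   = λ k k₀≲k → transfer 𝐚 ind∅ k₀ k k₀≲k (definable-AtMost b E) few
          ; constant = λ k k′ k₀≲k k₀≲k′ {y} χy →
              decidable-stable em λ ¬χy → stable (k , k′ , k₀≲k , k₀≲k′ , y , χy , ¬χy)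
          }
        ... | yes (k , k′ , k₀≲k , k₀≲k′ , y , χy , ¬χy)
          with b | transfer 𝐚 ind∅ k₀ k k₀≲k (definable-AtMost b E) few
        ...   | ℕ.zero  | [] , _ , ⊆[] = contradiction (⊆[] χy) λ ()
        -- The pair of `k` and `k′` is the new base. The point `y` solves `χ` at `k` but fails the
        -- conjunction, which lowers the bound by one.
        ...   | ℕ.suc b | fewk = stabilise b (finite-⊎ finX finX) [ k , k′ ]′
          (definable-× (pullback (extend (reindex inj₁)) E) (pullback (extend (reindex inj₂)) E))
          (member-transfer E k₀ k k₀≲k χd , member-transfer E k₀ k′ k₀≲k′ χd)
          (AtMost-remove proj₁ χy (¬χy ∘ proj₂) fewk)

        -- The entries named in the algebraic formula are reread as variables over all of `Index`,
        -- and `finite-support` cuts these down to a finite base from which `stabilise` can start.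
        stable : (s , d) ∈ acl M (entries M σ 𝐚) → Stable d
        stable (Δ , e , φ , sat , ys , ⊆ys) =
          let xs , Q , E , P⇔Q = finite-support {K = Constants ∅ ▷ s} (pullback ▷-inward solutions) in
          stabilise (length ys) (finite-Fin _) (lookup xs) (pullback ▷-outward E)
            (to (P⇔Q tuple (tt , d)) (from (sat-entries d) sat))
            (ys , ℕ.≤-refl , λ {y} → ⊆ys ∘ to (sat-entries y) ∘ from (P⇔Q tuple (tt , y)))
          where
          entry-variable : (Σ[ c ∈ Carrier t ] (t , c) ∈ entries M σ 𝐚) → Var (Pure Index) t
          entry-variable (_ , i , x , refl) = entry i x

          value-entry : (z : Σ[ c ∈ Carrier t ] (t , c) ∈ entries M σ 𝐚) →
            value (Pure Index) (entry-variable z) (tuple , tt) ≡ proj₁ z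
          value-entry (_ , i , x , refl) = refl

          solutions : Definable (Pure Index ▷ s) _
          solutions = record
            { variables = new ∷ All.map (old ∘ entry-variable) e ; formula = φ ; correct = λ _ → mk⇔ id id }

          sat-entries : ∀ y →
            (M ⊨ φ [ values-in (Pure Index ▷ s) ((tuple , tt) , y) (new ∷ All.map (old ∘ entry-variable) e) ]) ⇔
            (M ⊨ φ [ y ∷ values M e ])
          sat-entries y = subst (λ ρ → (M ⊨ φ [ y ∷ ρ ]) ⇔ (M ⊨ φ [ y ∷ values M e ]))
            (sym (trans (All.map-∘ e) (All.map-cong e value-entry))) (mk⇔ id id)

      module _ (ind : Indiscernible M σ 𝐚) where

        -- The stable formula for `d` has only sequence entries as parameters, so its solution set
        -- stays invariant whatever has been adjoined before, and `indisc-▷` applies at each step.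
        indiscernibleOver-aker : IndiscernibleOver M σ (aker M σ 𝐚) 𝐚
        indiscernibleOver-aker = indisc⇒indiscernibleOver {K₀ = Constants ∅} step
          (indiscernibleOver⇒indisc 𝐚 ind)
          where
          step : ∀ {Δ} (ρ : All Carrier Δ) {s} {d : Carrier s} → (s , d) ∈ aker M σ 𝐚 →
            Indisc 𝐚 (Constants ∅ ▷▷ Δ) (tt ▸▸ ρ) → Indisc 𝐚 (Constants ∅ ▷▷ Δ ▷ s) (tt ▸▸ ρ , d)
          step {Δ} ρ (d∈acl , ind-d) ind′ = indisc-▷ ind′ finPos base
            (pullback (extend (mapSeq id (weakens Δ))) formulaχ)
            (AtMost⇒Finite (atMost base (≲-≗ λ _ → refl))) constant member
            where open Stable (stable ind ind-d d∈acl)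

        -- An element algebraic over the kernel is algebraic over the sequence by idempotence of
        -- `acl`, and indiscernibility over the whole kernel extends to its closure.
        aker-acl : aker M σ 𝐚 ≐ acl M (aker M σ 𝐚)
        aker-acl = acl-extensive , λ d∈ →
          acl-idem (acl-mono proj₁ d∈) ,
          indiscernibleOver-mono (λ { refl → d∈ }) (indiscernibleOver-acl indiscernibleOver-aker)

    -- Cleanly collinear sequences.

    record Joined (𝐚 𝐛 : Sequence M σ) : Set (suc (suc ℓ)) where
      private
        module 𝐚 = Sequence 𝐚
        module 𝐛 = Sequence 𝐛
      field
        𝐜             : Sequence M σ
        indiscernible : Indiscernible M σ 𝐜
      module 𝐜 = Sequence 𝐜
      field
        left        : 𝐚.Index → 𝐜.Index
        right       : 𝐛.Index → 𝐜.Index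
        left-tuple  : 𝐜.tuple ∘ left ≡ 𝐚.tuple
        right-tuple : 𝐜.tuple ∘ right ≡ 𝐛.tuple
        left-mono   : left Preserves 𝐚._<_ ⟶ 𝐜._<_
        right-mono  : right Preserves 𝐛._<_ ⟶ 𝐜._<_
        separated   : (∀ i j → left i 𝐜.< right j) ⊎ (∀ i j → right j 𝐜.< left i)

    -- Which sequence comes first is recorded only in `separated`, so one argument serves both
    -- concatenations and both roles.
    joined-sym : {𝐚 𝐛 : Sequence M σ} → Joined 𝐚 𝐛 → Joined 𝐛 𝐚
    joined-sym J = record
      { 𝐜             = 𝐜
      ; indiscernible = indiscernible
      ; left          = right
      ; right         = left
      ; left-tuple    = right-tuple
      ; right-tuple   = left-tuple
      ; left-mono     = right-mono
      ; right-mono    = left-mono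
      ; separated     = Sum.swap (Sum.map (λ h i j → h j i) (λ h i j → h j i) separated)
      }
      where open Joined J

    concatenate-joined : {𝐚 𝐛 : Sequence M σ} → Indiscernible M σ (concatenate M σ 𝐚 𝐛) → Joined 𝐚 𝐛
    concatenate-joined {𝐚} {𝐛} ind = record
      { 𝐜             = concatenate M σ 𝐚 𝐛
      ; indiscernible = ind
      ; left          = inj₁
      ; right         = inj₂
      ; left-tuple    = refl
      ; right-tuple   = refl
      ; left-mono     = ₁∼₁
      ; right-mono    = ₂∼₂
      ; separated     = inj₁ λ _ _ → ₁∼₂
      }

    cleanlyCollinear⇒joined : {a b : IndiscernibleSequence M σ} →
      CleanlyCollinear M σ a b → Joined (proj₁ a) (proj₁ b)
    cleanlyCollinear⇒joined = [ concatenate-joined , joined-sym ∘ concatenate-joined ]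

    module _ {𝐚 𝐛 : Sequence M σ} (J : Joined 𝐚 𝐛) where
      private
        module 𝐚 = Sequence 𝐚
        module 𝐛 = Sequence 𝐛
      open Joined J

      private
        ind𝐜 : Indisc 𝐜 (Constants ∅) tt
        ind𝐜 = indiscernibleOver⇒indisc 𝐜 indiscernible

      -- All of `𝐛` lies on one side of `𝐚`, so moving an increasing tuple within `𝐚` does not
      -- change its order pattern relative to `𝐛`. The joint tuple includes every index of `𝐛`,
      -- which `transfer` permits.
      indiscernibleOver-entries : IndiscernibleOver M σ (entries M σ 𝐛) 𝐚
      indiscernibleOver-entries n i j i↑ j↑ zs Δ φ e = mk⇔ (half i j i↑ j↑) (half j i j↑ i↑)
        where
        Joint : Context (suc ℓ) (suc ℓ)
        Joint = Pure 𝐚 (Fin n ⊎ 𝐛.Index)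

        entry-variable : (Σ[ c ∈ Carrier t ] (t , c) ∈ entries M σ 𝐛) → Var Joint t
        entry-variable (_ , k , x , refl) = entry (inj₂ k) x

        vars : All (Var Joint) (map (σ ∘ proj₂) zs ++ Δ)
        vars = All.++⁺ (coordinates {τ = σ ∘ proj₂} (λ (k , x) → entry (inj₁ k) x) zs)
          (All.map entry-variable e)

        place : (Fin n → 𝐚.Index) → Fin n ⊎ 𝐛.Index → 𝐜.Index
        place i = [ left ∘ i , right ]′

        value-entry : ∀ i (z : Σ[ c ∈ Carrier t ] (t , c) ∈ entries M σ 𝐛) →
          value Joint (entry-variable z) (𝐜.tuple ∘ place i , tt) ≡ proj₁ z
        value-entry i (_ , k , x , refl) = cong (λ C → C k x) right-tuple

        values-vars : ∀ i → values-in Joint (𝐜.tuple ∘ place i , tt) vars ≡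
          All.++⁺ (restrict M (flatten M σ 𝐚 i) zs) (values M e)
        values-vars i = trans
          (map-++⁺ (λ x → value Joint x (𝐜.tuple ∘ place i , tt))
            (coordinates _ zs) (All.map entry-variable e))
          (cong₂ All.++⁺
            (trans (values-coordinates Joint (𝐜.tuple ∘ place i , tt) (λ (k , x) → entry (inj₁ k) x) zs)
              (cong (λ C → restrict M {σ = σ ∘ proj₂} (λ (k , x) → C (i k) x) zs) left-tuple))
            (trans (All.map-∘ e) (All.map-cong e (value-entry i))))

        place-≲ : ∀ i j → i Preserves Fin._<_ ⟶ 𝐚._<_ → j Preserves Fin._<_ ⟶ 𝐚._<_ →
          place i ⟨ 𝐜._<_ ⟩≲⟨ 𝐜._<_ ⟩ place j
        place-≲ i j i↑ j↑ = ≲-⊎ 𝐜.isStrictTotalOrder 𝐜.isStrictTotalOrder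
          (≲-trans (≲-sym Fin.<-isStrictTotalOrder 𝐜.isStrictTotalOrder (≲-monotone (left-mono ∘ i↑) id))
            (≲-monotone (left-mono ∘ j↑) id))
          (≲-≗ λ _ → refl)
          λ k l → Sum.map (λ h → h (i k) l , h (j k) l) (λ h → h (i k) l , h (j k) l) separated

        half : ∀ i j → i Preserves Fin._<_ ⟶ 𝐚._<_ → j Preserves Fin._<_ ⟶ 𝐚._<_ →
          M ⊨ φ [ All.++⁺ (restrict M (flatten M σ 𝐚 i) zs) (values M e) ] →
          M ⊨ φ [ All.++⁺ (restrict M (flatten M σ 𝐚 j) zs) (values M e) ]
        half i j i↑ j↑ h = subst (λ ρ → M ⊨ φ [ ρ ]) (values-vars j)
          (transfer 𝐜 ind𝐜 (place i) (place j) (place-≲ i j i↑ j↑)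
            record { variables = vars ; formula = φ ; correct = λ _ → mk⇔ id id }
            (subst (λ ρ → M ⊨ φ [ ρ ]) (sym (values-vars i)) h))

      -- The inclusion χ(k) ⊆ χ(k′), for k and k′ in 𝐚 lying on the same side of each
      -- other as 𝐚 and 𝐛, transfers to k in 𝐚 and k′ in 𝐛.
      stable⇒acl : {d : Carrier s} → Stable 𝐚 d → (s , d) ∈ acl M (entries M σ 𝐛)
      stable⇒acl {s = s} {d} S = algebraic⇒acl (algebraic-pullback (record
        { onVar   = λ { (entry y i) → 𝐛.tuple (k𝐛 y) i , k𝐛 y , i , refl ; (param ()) }
        ; onState = λ _ → 𝐛.tuple ∘ k𝐛 , tt
        ; onValue = λ { (entry y i) _ → refl ; (param ()) }
        }) over-𝐛)
        where
        open Stable S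
        open Sorting 𝐚.isStrictTotalOrder using (Enumeration; enumerate; Blocks; blocks)

        enumeration : Enumeration base
        enumeration = enumerate finPos base
        open Enumeration enumeration

        -- Of the two blocks, the one farther from `𝐛` serves as `k` and stays; the nearer one
        -- serves as `k′` and is replaced by `k𝐛`. Which is which depends on `separated`.
        open Blocks (blocks em↓ 𝐚.infinite 2 size)

        𝐛-chain : Σ[ c ∈ (Fin size → 𝐛.Index) ] c Preserves Fin._<_ ⟶ 𝐛._<_
        𝐛-chain = Sorting.chain 𝐛.isStrictTotalOrder em↓ 𝐛.infinite size

        k𝐛 : Pos → 𝐛.Index
        k𝐛 = proj₁ 𝐛-chain ∘ position

        low high : Pos → 𝐚.Index
        low  = block Fin.zero ∘ position
        high = block (Fin.suc Fin.zero) ∘ position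

        low<high : ∀ x y → low x 𝐚.< high y
        low<high x y = block-< {Fin.zero} {Fin.suc Fin.zero} (s≤s z≤n) (position x) (position y)

        base≲low : base ⟨ 𝐚._<_ ⟩≲⟨ 𝐚._<_ ⟩ low
        base≲low = ≲-copy 𝐚 enumeration (block-mono Fin.zero)

        base≲high : base ⟨ 𝐚._<_ ⟩≲⟨ 𝐚._<_ ⟩ high
        base≲high = ≲-copy 𝐚 enumeration (block-mono (Fin.suc Fin.zero))

        base≲k𝐛 : base ⟨ 𝐚._<_ ⟩≲⟨ 𝐛._<_ ⟩ k𝐛
        base≲k𝐛 = ≲-copy 𝐚 enumeration (proj₂ 𝐛-chain)

        -- The bound travels with the inclusion: the inclusion puts `d` among the solutions at `k𝐛`,
        -- and the bound makes these finite in number.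
        Included : Pred (State (Pure 𝐚 (Pos ⊎ Pos))) (suc ℓ)
        Included (C , _) = (∀ y → χ ((C ∘ inj₁ , tt) , y) → χ ((C ∘ inj₂ , tt) , y)) ×
          AtMost bound (λ y → χ ((C ∘ inj₂ , tt) , y))

        included-definable : Definable (Pure 𝐚 (Pos ⊎ Pos)) Included
        included-definable = definable-×
          (definable-∀ (definable-→
            (pullback (extend (reindex inj₁)) formulaχ)
            (pullback (extend (reindex inj₂)) formulaχ)))
          (definable-AtMost bound (pullback (extend (reindex inj₂)) formulaχ))

        over-𝐛-from : ∀ k k′ → base ⟨ 𝐚._<_ ⟩≲⟨ 𝐚._<_ ⟩ k → base ⟨ 𝐚._<_ ⟩≲⟨ 𝐚._<_ ⟩ k′ →
          (∀ x y → (left (k x) 𝐜.< left (k′ y) × left (k x) 𝐜.< right (k𝐛 y)) ⊎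
                   (left (k′ y) 𝐜.< left (k x) × right (k𝐛 y) 𝐜.< left (k x))) →
          Algebraic (Pure 𝐚 Pos) (𝐛.tuple ∘ k𝐛 , tt) d
        over-𝐛-from k k′ base≲k base≲k′ across = record
          { definable = formulaχ
          ; holds     = subst (λ C → χ ((C ∘ k𝐛 , tt) , d)) right-tuple (proj₁ included-𝐛 d
              (subst (λ C → χ ((C ∘ k , tt) , d)) (sym left-tuple)
                (constant base k (≲-≗ λ _ → refl) base≲k member)))
          ; finite    = AtMost⇒Finite (subst (λ C → AtMost bound (λ y → χ ((C ∘ k𝐛 , tt) , y)))
              right-tuple (proj₂ included-𝐛))
          }
          where
          included-𝐚 : Included (𝐜.tuple ∘ [ left ∘ k , left ∘ k′ ]′ , tt)
          included-𝐚 = subst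
            (λ C → (∀ y → χ ((C ∘ k , tt) , y) → χ ((C ∘ k′ , tt) , y)) ×
                   AtMost bound (λ y → χ ((C ∘ k′ , tt) , y)))
            (sym left-tuple) ((λ y → constant k k′ base≲k base≲k′) , atMost k′ base≲k′)

          included-𝐛 : Included (𝐜.tuple ∘ [ left ∘ k , right ∘ k𝐛 ]′ , tt)
          included-𝐛 = transfer 𝐜 ind𝐜 _ _
            (≲-⊎ 𝐜.isStrictTotalOrder 𝐜.isStrictTotalOrder (≲-≗ λ _ → refl)
              (≲-trans (≲-sym 𝐚.isStrictTotalOrder 𝐜.isStrictTotalOrder
                  (≲-trans base≲k′ (≲-monotone left-mono k′)))
                (≲-trans base≲k𝐛 (≲-monotone right-mono k𝐛)))
              across)
            included-definable included-𝐚

        over-𝐛 : Algebraic (Pure 𝐚 Pos) (𝐛.tuple ∘ k𝐛 , tt) d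
        over-𝐛 with separated
        ... | inj₁ left<right = over-𝐛-from low high base≲low base≲high
          λ x y → inj₁ (left-mono (low<high x y) , left<right _ _)
        ... | inj₂ right<left = over-𝐛-from high low base≲high base≲low
          λ x y → inj₂ (left-mono (low<high y x) , right<left _ _)

      -- A kernel element has a stable formula, which can be evaluated in `𝐛`. Conversely `𝐚` is
      -- indiscernible over the entries of `𝐛`, hence over their algebraic closure, and so over each
      -- element of it.
      aker≐acl∩acl : Indiscernible M σ 𝐚 →
        aker M σ 𝐚 ≐ acl M (entries M σ 𝐚) ∩ acl M (entries M σ 𝐛)
      aker≐acl∩acl ind =
        (λ (d∈acl , ind-d) → d∈acl , stable⇒acl (stable 𝐚 ind ind-d d∈acl)) ,
        λ (d∈acl𝐚 , d∈acl𝐛) → d∈acl𝐚 ,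
          indiscernibleOver-mono 𝐚 (λ { refl → d∈acl𝐛 })
            (indiscernibleOver-acl 𝐚 indiscernibleOver-entries)

    -- Both kernels equal the same intersection of closures, which is symmetric in the two
    -- sequences.
    cleanlyCollinear⇒aker : {a b : IndiscernibleSequence M σ} → CleanlyCollinear M σ a b →
      aker M σ (proj₁ a) ≐ aker M σ (proj₁ b)
    cleanlyCollinear⇒aker {a} {b} cc =
      proj₂ 𝐛≐ ∘ swap ∘ proj₁ 𝐚≐ , proj₂ 𝐚≐ ∘ swap ∘ proj₁ 𝐛≐
      where
      joined : Joined (proj₁ a) (proj₁ b)
      joined = cleanlyCollinear⇒joined {a} {b} cc

      𝐚≐ : aker M σ (proj₁ a) ≐ acl M (entries M σ (proj₁ a)) ∩ acl M (entries M σ (proj₁ b))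
      𝐚≐ = aker≐acl∩acl joined (proj₂ a)

      𝐛≐ : aker M σ (proj₁ b) ≐ acl M (entries M σ (proj₁ b)) ∩ acl M (entries M σ (proj₁ a))
      𝐛≐ = aker≐acl∩acl (joined-sym joined) (proj₂ b)

    ≈⇒aker : {a b : IndiscernibleSequence M σ} → _≈_ M σ a b →
      aker M σ (proj₁ a) ≐ aker M σ (proj₁ b)
    ≈⇒aker {a} {b} Plus.[ cc ] = cleanlyCollinear⇒aker {a} {b} cc
    ≈⇒aker {a} {b} (Plus._∷_ {y = c} cc cs) =
      let a⊆c , c⊆a = cleanlyCollinear⇒aker {a} {c} cc
          c⊆b , b⊆c = ≈⇒aker {c} {b} cs
      in c⊆b ∘ a⊆c , c⊆a ∘ b⊆c

theorem3p11 :
  ∀ {ℓ : Level} → ExcludedMiddle (suc ℓ) →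
  (L : Signature ℓ) (T : Theory L) → Consistent T → Complete T →
  (M : Structure L (suc ℓ)) → Models M T → Saturated M →
  (α : Set ℓ) (σ : α → Signature.Sort L) (a b : IndiscernibleSequence M σ) →
  let 𝐚 = proj₁ a
      𝐛 = proj₁ b
  in (_≈_ M σ a b → aker M σ 𝐚 ≐ aker M σ 𝐛)
   × (CleanlyCollinear M σ a b →
        aker M σ 𝐚 ≐ acl M (entries M σ 𝐚) ∩ acl M (entries M σ 𝐛))
   × (aker M σ 𝐚 ≐ acl M (aker M σ 𝐚))
   × IndiscernibleOver M σ (aker M σ 𝐚) 𝐚
theorem3p11 em L T _ _ M _ _ α σ a b =
  ≈⇒aker {a} {b} ,
  (λ cc → aker≐acl∩acl (cleanlyCollinear⇒joined {a} {b} cc) (proj₂ a)) ,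
  aker-acl (proj₁ a) (proj₂ a) ,
  indiscernibleOver-aker (proj₁ a) (proj₂ a)
  where
  open Definability em M
  open Sequences σ
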